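{- Let $m \in \mathbb{N}$ and $a = (a_1,\dots,a_m) \in \mathbb{N}^m$ with $a_j \ge 2$ for all $j \in \{1,\dots,m\}$. Then the number $N_a$ of different joint ordered factorisations of $a$ is $$N_a = \sum_{l \in \mathbb{N}^m} \binom{|l|}{l} \prod_{j=1}^m c_{l_j}^{(-l_j)}(a_j),$$ where the sum has only finitely many nonzero terms.
   Context: A joint ordered factorisation of $a \in \mathbb{N}^m$ is a tuple $((j_1,f_1),(j_2,f_2),\dots,(j_L,f_L)) \in (\{1,\dots,m\} \times \{2,3,4,\dots\})^L$ for some $L \in \mathbb{N}$ such that $\prod_{l:\, j_l = j} f_l = a_j$ for every $j \in \{1,\dots,m\}$ and $j_l \ne j_{l-1}$ for all $l \in \{2,\dots,L\}$. Arithmetic functions are maps $\mathbb{N}\to\mathbb{C}$ with Dirichlet convolution $(f*g)(n) = \sum_{n_1 n_2 = n} f(n_1)g(n_2)$; $f^{*j}$ is the $j$-fold convolution power, $f^{*0} = e$ with $e(n) = \delta_{n,1}$; $1$ is the constant function $1$ and $\mu$ the Möbius function. For $j \in \mathbb{N}_0$, $c_j^{(-j)} = (1-e)^{*j} * \mu^{*j}$; equivalently $c_j^{(-j)}(n)$ equals $(-1)^{\Omega(n)+j}$ times the number of ordered factorisations of $n$ into $j$ square-free factors each $>1$, where $\Omega(n)$ is the number of prime factors of $n$ counted with multiplicity. For $l \in \mathbb{N}^m$, $|l| = l_1+\dots+l_m$ and $\binom{|l|}{l} = |l|!/(l_1!\cdots l_m!)$. -}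

module Defs where

open import Data.Nat as ℕ using (ℕ; zero; suc; _≤_; _<_; _!; NonZero; _/_)
open import Data.Nat.Properties using (_!≢0; m*n≢0)
open import Data.Nat.Divisibility using (_∣_; _∣?_)
open import Data.Integer as ℤ using (ℤ; +_; -_)
open import Data.Fin using (Fin; _≟_)
open import Data.Vec.Functional using (Vector; head; tail) renaming (_∷_ to _∷ᵥ_)
open import Data.List using (List; []; _∷_; upTo; map; foldr)
open import Data.List.Relation.Unary.All using (All)
open import Data.List.Relation.Unary.Linked using (Linked)
open import Data.Product using (_×_; _,_; proj₁; proj₂)
open import Relation.Binary.PropositionalEquality using (_≡_; _≢_)
open import Relation.Nullary using (yes; no)

-- Arithmetic functions ℕ → ℤ (only values at n ≥ 1 are meaningful)

ArithFun : Set
ArithFun = ℕ → ℤ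

Σℤ : List ℤ → ℤ
Σℤ = foldr ℤ._+_ (+ 0)

_⋆_ : ArithFun → ArithFun → ArithFun
(f ⋆ g) n = Σℤ (map term (upTo n))
  where
  term : ℕ → ℤ
  term k with suc k ∣? n
  ... | yes _ = f (suc k) ℤ.* g (n / suc k)
  ... | no  _ = + 0

e : ArithFun
e (suc zero) = + 1
e _          = + 0

𝟙 : ArithFun
𝟙 _ = + 1

_^⋆_ : ArithFun → ℕ → ArithFun
f ^⋆ zero  = e
f ^⋆ suc j = f ⋆ (f ^⋆ j)

-- Möbius function: μ(n) = 0 if n is not square-free, otherwise (-1)^k
-- where k is the number of prime factors of n.  Computed by trial
-- division: μaux fuel n d processes the remaining cofactor n with
-- current trial divisor d (all prime factors < d already removed).
μaux : ℕ → ℕ → ℕ → ℤ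
μaux zero    n d = + 1
μaux (suc k) n (suc d) with n ℕ.≤? 1
... | yes _ = + 1
... | no  _ with suc d ∣? n
...   | no  _ = μaux k n (suc (suc d))
...   | yes _ with suc d ℕ.* suc d ∣? n
...     | yes _ = + 0
...     | no  _ = - μaux k (n / suc d) (suc (suc d))
μaux (suc k) n zero = + 1  -- never used (trial divisors start at 2)

μ : ArithFun
μ n = μaux n n 2

c : ℕ → ArithFun
c j = ((λ n → 𝟙 n ℤ.- e n) ^⋆ j) ⋆ (μ ^⋆ j)

∣_∣ᵥ : ∀ {m} → Vector ℕ m → ℕ
∣_∣ᵥ {zero}  l = 0
∣_∣ᵥ {suc m} l = head l ℕ.+ ∣ tail l ∣ᵥ

factProd : ∀ {m} → Vector ℕ m → ℕ
factProd {zero}  l = 1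
factProd {suc m} l = head l ! ℕ.* factProd (tail l)

factProd≢0 : ∀ {m} (l : Vector ℕ m) → NonZero (factProd l)
factProd≢0 {zero}  l = _
factProd≢0 {suc m} l =
  m*n≢0 (head l !) (factProd (tail l)) {{head l !≢0}} {{factProd≢0 (tail l)}}

multinomial : ∀ {m} → Vector ℕ m → ℕ
multinomial l = (∣ l ∣ᵥ !) / factProd l
  where instance _ = factProd≢0 l

Πℤ : ∀ {m} → Vector ℤ m → ℤ
Πℤ {zero}  v = + 1
Πℤ {suc m} v = head v ℤ.* Πℤ (tail v)

summand : ∀ {m} → Vector ℕ m → Vector ℕ m → ℤ
summand a l = + multinomial l ℤ.* Πℤ (λ j → c (l j) (a j))

boxSum : ∀ {m} → Vector ℕ m → (Vector ℕ m → ℤ) → ℤ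
boxSum {zero}  b F = F (λ ())
boxSum {suc m} b F =
  Σℤ (map (λ k → boxSum (tail b) (λ l → F (suc k ∷ᵥ l))) (upTo (head b)))

-- Joint ordered factorisations
-- A tuple ((j_1,f_1),…,(j_L,f_L)) is a list of pairs (j , f) with
-- j ∈ Fin m (standing for {1,…,m}) and f ≥ 2.

prodAt : ∀ {m} → Fin m → List (Fin m × ℕ) → ℕ
prodAt j []             = 1
prodAt j ((i , f) ∷ xs) with i ≟ j
... | yes _ = f ℕ.* prodAt j xs
... | no  _ = prodAt j xs

IsJointOrdFact : ∀ {m} → Vector ℕ m → List (Fin m × ℕ) → Set
IsJointOrdFact a t =
  All (λ p → 2 ≤ proj₂ p) t
  × Linked (λ p q → proj₁ p ≢ proj₁ q) t
  × (∀ j → prodAt j t ≡ a j)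

{-# OPTIONS --safe #-}
module Submission where

-- Idea.  Put y = (𝟙 − e) ⋆ μ, so that c i = y^⋆i, and let Y be the sum over j of
-- "convolve with y in coordinate j".  The right-hand side is the value at a of
-- (1 − Y)⁻¹ applied to the unit: it satisfies N = unit + Σⱼ Nⱼ with Nⱼ = y ⋆ⱼ N.
-- Since 𝟙 ⋆ μ = e gives 𝟙 ⋆ y = 𝟙 − e, this Nⱼ also satisfies
-- Nⱼ = (𝟙 − e) ⋆ⱼ (N − Nⱼ).  That is the recurrence for the number of joint
-- ordered factorisations starting in coordinate j: remove the first factor, which
-- is at least 2, and continue with one that does not start in coordinate j.

open import Defs
open import Algebra.Bundles using (CommutativeMonoid)
open import Data.Bool using (if_then_else_)
open import Data.Empty using (⊥)
open import Data.Fin as Fin using (Fin; zero; suc; toℕ; fromℕ<; punchIn; punchOut)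
open import Data.Fin.Properties using (suc-injective; toℕ<n; toℕ-injective; toℕ-fromℕ<; punchInᵢ≢i; punchIn-injective; punchIn-punchOut)
open import Data.Integer as ℤ using (ℤ; +_; -_; _+_; _*_; _-_)
import Data.Integer.Properties as ℤₚ
open import Data.Integer.Tactic.RingSolver using (solve-∀)
open import Data.List as List using (List; []; _∷_; _++_; length; map; upTo; applyUpTo)
open import Data.List.Membership.Propositional using (_∈_)
open import Data.List.Membership.Propositional.Properties using (∈-++⁺ˡ; ∈-++⁺ʳ; ∈-++⁻; ∈-map⁺; ∈-map⁻)
open import Data.List.Properties using (length-++; length-map; map-cong; map-upTo; ∷-injectiveˡ; ∷-injectiveʳ)
open import Data.List.Relation.Unary.All using ([]; _∷_)
open import Data.List.Relation.Unary.AllPairs using ([]; _∷_)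
open import Data.List.Relation.Unary.Any using (here)
open import Data.List.Relation.Unary.Linked using (Linked; []; [-]; _∷_)
open import Data.List.Relation.Unary.Unique.Propositional using (Unique)
import Data.List.Relation.Unary.Unique.Propositional.Properties as Unique
open import Data.Nat as ℕ using (ℕ; zero; suc; _≤_; _<_; z≤n; s≤s; _/_; NonZero; _!)
open import Data.Nat.Coprimality using (prime⇒coprime; coprime-divisor) renaming (sym to coprime-sym)
open import Data.Nat.Divisibility using (_∣_; _∣?_; divides; ∣⇒≤; m∣m*n; ∣-trans; *-cancelʳ-∣; *-monoˡ-∣; ∣n⇒∣m*n; ∣m⇒∣m*n; _∣0; ∣1⇒≡1)
open import Data.Nat.DivMod using (m*n/n≡m)
open import Data.Nat.ListAction using (product)
open import Data.Nat.Primality using (Prime; ¬prime[0]; euclidsLemma; prime⇒nonTrivial)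
open import Data.Nat.Primality.Factorisation using (factorise)
import Data.Nat.Properties as ℕₚ
import Data.Nat.Tactic.RingSolver as ℕ-Solver
open import Data.Product using (Σ; _,_; ∃; ∃₂; _×_; proj₁; proj₂)
open import Data.Sum using (_⊎_; inj₁; inj₂)
open import Data.Vec as Vec using (Vec; []; _∷_; lookup; _[_]≔_; tabulate)
open import Data.Vec.Functional using (Vector; head; tail) renaming (_∷_ to _∷ᵥ_)
open import Data.Vec.Properties using (lookup∘update; lookup∘update′; []≔-idempotent; lookup∘tabulate)
open import Data.Vec.Relation.Unary.All as All using (All; []; _∷_)
open import Data.Vec.Relation.Unary.All.Properties using (lookup⁺; lookup⁻; tabulate⁺)
open import Function using (_∘_; id; _⇔_; mk⇔; Equivalence)
open import Relation.Binary.PropositionalEquality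
open import Relation.Binary.Structures using (IsEquivalence)
open import Relation.Nullary using (Dec; yes; no; does; ¬_; ¬?; contradiction)
open import Algebra.Properties.Semiring.Sum ℤₚ.+-*-semiring
  using (sum; sum-remove; ∑-distrib-+; ∑-comm; sum-cong-≗; *-distribˡ-sum; sum-replicate-zero)
open ≡-Reasoning

-- Finite sums and Dirichlet convolution

-- The series in `Y` is taken apart one coordinate at a time. With `Y = y₁ + Y′`, where `y₁` acts on
-- the first coordinate only, `(1 − Y)⁻ˢ` is the sum over `i` of `multichoose s i` times
-- `y₁ⁱ (1 − Y′)⁻⁽ˢ⁺ⁱ⁾`. The exponent changes with the coordinate, so it has to stay general both in
-- the recurrence and in the comparison with the multinomial sum, although only `s = 1` matters in
-- the end. All series are finite sums, because `y` vanishes at `1`. The form `y ⋆ⱼ N` has terms of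
-- both signs and counts nothing directly. In `(𝟙 − e) ⋆ⱼ (N − Nⱼ)` every coefficient is `0` or `1`,
-- and only vectors with a smaller `j`-th entry occur, so this form can be matched with an explicit
-- list by induction. A separate obstacle is `𝟙 ⋆ μ = e`: here `μ` is a trial division with fuel, so
-- its behaviour at primes must first be read off from the algorithm.

sum-zero : ∀ {n} (t : Fin n → ℤ) → (∀ i → t i ≡ + 0) → sum t ≡ + 0
sum-zero {n} t t≡0 = trans (sum-cong-≗ t≡0) (sum-replicate-zero n)

sum-only : ∀ {n} (t : Fin n → ℤ) k → (∀ i → i ≢ k → t i ≡ + 0) → sum t ≡ t k
sum-only {suc n} t k t≡0 = begin
  sum t                             ≡⟨ sum-remove {i = k} t ⟩
  t k + sum (λ i → t (punchIn k i)) ≡⟨ cong (_+_ (t k)) (sum-zero _ λ i → t≡0 _ (punchInᵢ≢i k i)) ⟩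
  t k + + 0                         ≡⟨ ℤₚ.+-identityʳ _ ⟩
  t k                               ∎

opaque
  -- Indexed by `ℕ` rather than by `Fin n`, so that sums with different bounds can share one
  -- summand.
  ∑< : ℕ → (ℕ → ℤ) → ℤ
  ∑< n t = sum {n} (t ∘ toℕ)

  ∑<-sum : ∀ n t → ∑< n t ≡ sum {n} (t ∘ toℕ)
  ∑<-sum n t = refl

  ∑<-cong : ∀ n {s t : ℕ → ℤ} → (∀ i → i < n → s i ≡ t i) → ∑< n s ≡ ∑< n t
  ∑<-cong n s≡t = sum-cong-≗ {n} λ i → s≡t (toℕ i) (toℕ<n i)

  ∑<-zero : ∀ n (t : ℕ → ℤ) → (∀ i → i < n → t i ≡ + 0) → ∑< n t ≡ + 0
  ∑<-zero n t t≡0 = sum-zero {n} _ λ i → t≡0 (toℕ i) (toℕ<n i)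

  ∑<-only : ∀ n (t : ℕ → ℤ) {k} → k < n → (∀ i → i ≢ k → t i ≡ + 0) → ∑< n t ≡ t k
  ∑<-only n t {k} k<n t≡0 = trans
    (sum-only {n} _ (fromℕ< k<n) λ i i≢k → t≡0 (toℕ i) λ i≡k →
      i≢k (toℕ-injective (trans i≡k (sym (toℕ-fromℕ< k<n)))))
    (cong t (toℕ-fromℕ< k<n))

  ∑<-distrib-+ : ∀ n (s t : ℕ → ℤ) → ∑< n (λ i → s i + t i) ≡ ∑< n s + ∑< n t
  ∑<-distrib-+ n s t = ∑-distrib-+ {n} _ _

  ∑<-distribˡ-* : ∀ n x (t : ℕ → ℤ) → x * ∑< n t ≡ ∑< n (λ i → x * t i)
  ∑<-distribˡ-* n x t = *-distribˡ-sum {n} x _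

  ∑<-comm : ∀ m n (t : ℕ → ℕ → ℤ) →
            ∑< m (λ i → ∑< n (t i)) ≡ ∑< n (λ j → ∑< m (λ i → t i j))
  ∑<-comm m n t = ∑-comm {m} {n} _

  ∑<-sum-comm : ∀ {m} n (t : Fin m → ℕ → ℤ) →
                sum (λ j → ∑< n (t j)) ≡ ∑< n (λ i → sum (λ j → t j i))
  ∑<-sum-comm {m} n t = ∑-comm {m} {n} _

  ∑<-last : ∀ n (t : ℕ → ℤ) → ∑< (suc n) t ≡ ∑< n t + t n
  ∑<-last zero    t = ℤₚ.+-comm (t 0) (+ 0)
  ∑<-last (suc n) t = trans (cong (_+_ (t 0)) (∑<-last n (t ∘ suc))) (sym (ℤₚ.+-assoc (t 0) _ _))

  ∑<-extend : ∀ {m n} (t : ℕ → ℤ) → m ≤ n → (∀ i → m ≤ i → t i ≡ + 0) → ∑< m t ≡ ∑< n t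
  ∑<-extend {n = n} t z≤n t≡0 = sym (∑<-zero n t λ i _ → t≡0 i z≤n)
  ∑<-extend t (s≤s m≤n) t≡0 = cong (_+_ (t 0)) (∑<-extend (t ∘ suc) m≤n λ i m≤i → t≡0 (suc i) (s≤s m≤i))

  Σℤ-upTo : ∀ t n → Σℤ (map t (upTo n)) ≡ ∑< n t
  Σℤ-upTo t n = trans (cong Σℤ (map-upTo t n)) (Σℤ-applyUpTo t n)
    where
    Σℤ-applyUpTo : ∀ t n → Σℤ (applyUpTo t n) ≡ ∑< n t
    Σℤ-applyUpTo t zero    = refl
    Σℤ-applyUpTo t (suc n) = cong (_+_ (t 0)) (Σℤ-applyUpTo (t ∘ suc) n)

  ∑<-first : ∀ n (t : ℕ → ℤ) → ∑< (suc n) t ≡ t 0 + ∑< n (t ∘ suc)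
  ∑<-first n t = refl

opaque
  -- The Iverson bracket. As a factor, a divisibility condition does not disturb linearity in the
  -- other factors.
  ⟦_⟧ : ∀ {P : Set} → Dec P → ℤ
  ⟦ P? ⟧ = if does P? then + 1 else + 0

  ⟦⟧-*-zero : ∀ {P : Set} (P? : Dec P) x → ¬ P → ⟦ P? ⟧ * x ≡ + 0
  ⟦⟧-*-zero (yes p) x ¬p = contradiction p ¬p
  ⟦⟧-*-zero (no _)  x _  = refl

  ⟦⟧-*-one : ∀ {P : Set} (P? : Dec P) x → P → ⟦ P? ⟧ * x ≡ x
  ⟦⟧-*-one (yes _) x _ = ℤₚ.*-identityˡ x
  ⟦⟧-*-one (no ¬p) x p = contradiction p ¬p

-- The summand of _⋆_ is not nameable here; the type of ⋆-term is found
-- by unification when ⋆-∑ is checked.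
mutual
  ⋆-∑ : ∀ f g n → (f ⋆ g) n ≡ ∑< n (λ k → ⟦ suc k ∣? n ⟧ * (f (suc k) * g (n / suc k)))
  ⋆-∑ f g n = trans (cong Σℤ (map-cong (λ k → ⋆-term f g n k) (upTo n))) (Σℤ-upTo _ n)

  ⋆-term : ∀ f g n k → _ ≡ ⟦ suc k ∣? n ⟧ * (f (suc k) * g (n / suc k))
  ⋆-term f g n k with suc k ∣? n
  ... | yes k∣n = sym (⟦⟧-*-one (yes k∣n) _ k∣n)
  ... | no  k∤n = sym (⟦⟧-*-zero (no k∤n) _ k∤n)

opaque
  δ : ℕ → ℕ → ℤ
  δ m n = ⟦ m ℕ.≟ n ⟧

  δ-≡ : ∀ {m n} x → m ≡ n → δ m n * x ≡ x
  δ-≡ x = ⟦⟧-*-one (_ ℕ.≟ _) x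

  δ-≢ : ∀ {m n} x → m ≢ n → δ m n * x ≡ + 0
  δ-≢ x = ⟦⟧-*-zero (_ ℕ.≟ _) x

δ-cong : ∀ m n {x y} → (m ≡ n → x ≡ y) → δ m n * x ≡ δ m n * y
δ-cong m n {x} {y} x≡y with m ℕ.≟ n
... | yes m≡n = cong (_*_ (δ m n)) (x≡y m≡n)
... | no  m≢n = trans (δ-≢ x m≢n) (sym (δ-≢ y m≢n))

-- Divisor and cofactor become independent indices, so commutativity is an exchange of sums. The
-- bound is free because factors of `suc n` are at most `suc n`; associativity needs one bound for
-- several arguments.
⋆-∑∑ : ∀ f g n {B} → suc n ≤ B → (f ⋆ g) (suc n) ≡
       ∑< B λ d → ∑< B λ q → δ (suc d ℕ.* suc q) (suc n) * (f (suc d) * g (suc q))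
⋆-∑∑ f g n {B} n<B = begin
  (f ⋆ g) (suc n)  ≡⟨ ⋆-∑ f g (suc n) ⟩
  ∑< (suc n) outer ≡⟨ ∑<-extend outer n<B (λ k n<k → ⟦⟧-*-zero (suc k ∣? suc n) _
                        λ k∣n → ℕₚ.<⇒≱ (s≤s n<k) (∣⇒≤ k∣n)) ⟩
  ∑< B outer       ≡⟨ ∑<-cong B (λ d _ → outer≡inner d) ⟩
  _                ∎
  where
  outer : ℕ → ℤ
  outer k = ⟦ suc k ∣? suc n ⟧ * (f (suc k) * g (suc n / suc k))

  inner : ℕ → ℕ → ℤ
  inner d q = δ (suc d ℕ.* suc q) (suc n) * (f (suc d) * g (suc q))

  outer≡inner : ∀ d → outer d ≡ ∑< B (inner d)
  outer≡inner d with suc d ∣? suc n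
  ... | no d∤n = trans (⟦⟧-*-zero (no d∤n) _ d∤n) (sym (∑<-zero B (inner d) λ q _ →
                   δ-≢ _ λ dq≡n → d∤n (subst (suc d ∣_) dq≡n (m∣m*n (suc q)))))
  ... | yes d∣n@(divides (suc q) n≡qd) = begin
    ⟦ yes d∣n ⟧ * (f (suc d) * g (suc n / suc d))
      ≡⟨ ⟦⟧-*-one (yes d∣n) _ d∣n ⟩
    f (suc d) * g (suc n / suc d)
      ≡⟨ cong (λ x → f (suc d) * g x) (trans (cong (_/ suc d) n≡qd) (m*n/n≡m (suc q) (suc d))) ⟩
    f (suc d) * g (suc q)
      ≡⟨ δ-≡ _ dq≡n ⟨
    inner d q
      ≡⟨ ∑<-only B (inner d) q<B (λ i i≢q → δ-≢ _
           λ di≡n → i≢q (ℕₚ.suc-injective (ℕₚ.*-cancelˡ-≡ _ _ (suc d) (trans di≡n (sym dq≡n))))) ⟨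
    ∑< B (inner d) ∎
    where
    dq≡n : suc d ℕ.* suc q ≡ suc n
    dq≡n = trans (ℕₚ.*-comm (suc d) (suc q)) (sym n≡qd)
    q<B : q < B
    q<B = ℕₚ.≤-trans (subst (suc q ≤_) (sym n≡qd) (ℕₚ.m≤m*n (suc q) (suc d))) n<B

⋆-cong-local : ∀ {f g f′ g′} n →
  (∀ d q → suc d ℕ.* suc q ≡ suc n → f (suc d) * g (suc q) ≡ f′ (suc d) * g′ (suc q)) →
  (f ⋆ g) (suc n) ≡ (f′ ⋆ g′) (suc n)
⋆-cong-local {f} {g} {f′} {g′} n eq = begin
  (f ⋆ g) (suc n)   ≡⟨ ⋆-∑∑ f g n ℕₚ.≤-refl ⟩
  _                 ≡⟨ ∑<-cong (suc n) (λ d _ → ∑<-cong (suc n) λ q _ →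
                         δ-cong (suc d ℕ.* suc q) (suc n) (eq d q)) ⟩
  _                 ≡⟨ ⋆-∑∑ f′ g′ n ℕₚ.≤-refl ⟨
  (f′ ⋆ g′) (suc n) ∎

⋆-vanish : ∀ {f g} n → (∀ d q → suc d ℕ.* suc q ≡ suc n → f (suc d) * g (suc q) ≡ + 0) →
           (f ⋆ g) (suc n) ≡ + 0
⋆-vanish {f} {g} n eq = trans (⋆-∑∑ f g n ℕₚ.≤-refl)
  (∑<-zero (suc n) _ λ d _ → ∑<-zero (suc n) _ λ q _ →
    trans (δ-cong (suc d ℕ.* suc q) (suc n) (eq d q)) (ℤₚ.*-zeroʳ (δ (suc d ℕ.* suc q) (suc n))))

-- The commutative monoid of arithmetic functions

⋆-distribˡ-+ : ∀ f g h n → (f ⋆ (λ k → g k + h k)) n ≡ (f ⋆ g) n + (f ⋆ h) n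
⋆-distribˡ-+ f g h n = begin
  (f ⋆ (λ k → g k + h k)) n
    ≡⟨ ⋆-∑ f _ n ⟩
  ∑< n (λ k → ⟦ suc k ∣? n ⟧ * (f (suc k) * (g (n / suc k) + h (n / suc k))))
    ≡⟨ ∑<-cong n (λ k _ → rearrange ⟦ suc k ∣? n ⟧ (f (suc k)) (g (n / suc k)) (h (n / suc k))) ⟩
  ∑< n (λ k → ⟦ suc k ∣? n ⟧ * (f (suc k) * g (n / suc k)) + ⟦ suc k ∣? n ⟧ * (f (suc k) * h (n / suc k)))
    ≡⟨ ∑<-distrib-+ n _ _ ⟩
  _
    ≡⟨ cong₂ _+_ (⋆-∑ f g n) (⋆-∑ f h n) ⟨
  (f ⋆ g) n + (f ⋆ h) n ∎
  where
  rearrange : ∀ a b c d → a * (b * (c + d)) ≡ a * (b * c) + a * (b * d)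
  rearrange = solve-∀

⋆-*ʳ : ∀ x f g n → (f ⋆ (λ k → x * g k)) n ≡ x * (f ⋆ g) n
⋆-*ʳ x f g n = begin
  (f ⋆ (λ k → x * g k)) n
    ≡⟨ ⋆-∑ f _ n ⟩
  ∑< n (λ k → ⟦ suc k ∣? n ⟧ * (f (suc k) * (x * g (n / suc k))))
    ≡⟨ ∑<-cong n (λ k _ → rearrange ⟦ suc k ∣? n ⟧ (f (suc k)) x (g (n / suc k))) ⟩
  ∑< n (λ k → x * (⟦ suc k ∣? n ⟧ * (f (suc k) * g (n / suc k))))
    ≡⟨ ∑<-distribˡ-* n x _ ⟨
  _
    ≡⟨ cong (_*_ x) (⋆-∑ f g n) ⟨
  x * (f ⋆ g) n ∎
  where
  rearrange : ∀ a b c d → a * (b * (c * d)) ≡ c * (a * (b * d))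
  rearrange = solve-∀

⋆-∑<ʳ : ∀ m f (t : ℕ → ArithFun) n → (f ⋆ (λ k → ∑< m (λ i → t i k))) n ≡ ∑< m (λ i → (f ⋆ t i) n)
⋆-∑<ʳ m f t n = begin
  (f ⋆ (λ k → ∑< m (λ i → t i k))) n
    ≡⟨ ⋆-∑ f _ n ⟩
  ∑< n (λ k → ⟦ suc k ∣? n ⟧ * (f (suc k) * ∑< m (λ i → t i (n / suc k))))
    ≡⟨ ∑<-cong n (λ k _ → trans (cong (_*_ ⟦ suc k ∣? n ⟧) (∑<-distribˡ-* m (f (suc k)) _))
         (∑<-distribˡ-* m ⟦ suc k ∣? n ⟧ _)) ⟩
  ∑< n (λ k → ∑< m (λ i → ⟦ suc k ∣? n ⟧ * (f (suc k) * t i (n / suc k))))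
    ≡⟨ ∑<-comm n m _ ⟩
  ∑< m (λ i → ∑< n (λ k → ⟦ suc k ∣? n ⟧ * (f (suc k) * t i (n / suc k))))
    ≡⟨ ∑<-cong m (λ i _ → ⋆-∑ f (t i) n) ⟨
  ∑< m (λ i → (f ⋆ t i) n) ∎

infix 4 _≈_

-- The argument `0` is left out: `(f ⋆ g) 0` is an empty sum, so `e` would not be an identity there.
_≈_ : ArithFun → ArithFun → Set
f ≈ g = ∀ n → f (suc n) ≡ g (suc n)

≈-isEquivalence : IsEquivalence _≈_
≈-isEquivalence = record
  { refl  = λ _ → refl
  ; sym   = λ f≈g n → sym (f≈g n)
  ; trans = λ f≈g g≈h n → trans (f≈g n) (g≈h n)
  }

⋆-cong : ∀ {f f′ g g′} → f ≈ f′ → g ≈ g′ → f ⋆ g ≈ f′ ⋆ g′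
⋆-cong f≈f′ g≈g′ n = ⋆-cong-local n λ d q _ → cong₂ _*_ (f≈f′ d) (g≈g′ q)

⋆-comm : ∀ f g → f ⋆ g ≈ g ⋆ f
⋆-comm f g n = begin
  (f ⋆ g) (suc n) ≡⟨ ⋆-∑∑ f g n ℕₚ.≤-refl ⟩
  _               ≡⟨ ∑<-comm (suc n) (suc n) _ ⟩
  _               ≡⟨ ∑<-cong (suc n) (λ d _ → ∑<-cong (suc n) λ q _ → cong₂ _*_
                       (cong (λ m → δ m (suc n)) (ℕₚ.*-comm (suc q) (suc d)))
                       (ℤₚ.*-comm (f (suc q)) (g (suc d)))) ⟩
  _               ≡⟨ ⋆-∑∑ g f n ℕₚ.≤-refl ⟨
  (g ⋆ f) (suc n) ∎

-- Expanding both convolutions introduces the intermediate product `suc u`; summing over `u` first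
-- eliminates it and leaves an expression that treats the three factors alike.
⋆-∑∑∑ : ∀ f g h n → ((f ⋆ g) ⋆ h) (suc n) ≡
  ∑< (suc n) λ w → ∑< (suc n) λ d → ∑< (suc n) λ q →
    δ (suc d ℕ.* suc q ℕ.* suc w) (suc n) * (f (suc d) * g (suc q) * h (suc w))
⋆-∑∑∑ f g h n = begin
  ((f ⋆ g) ⋆ h) (suc n)
    ≡⟨ ⋆-∑∑ (f ⋆ g) h n ℕₚ.≤-refl ⟩
  ∑< N (λ u → ∑< N λ w → δ (suc u ℕ.* suc w) N * ((f ⋆ g) (suc u) * h (suc w)))
    ≡⟨ ∑<-comm N N _ ⟩
  ∑< N (λ w → ∑< N λ u → δ (suc u ℕ.* suc w) N * ((f ⋆ g) (suc u) * h (suc w)))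
    ≡⟨ ∑<-cong N (λ w _ → ∑<-cong N λ u u<N → expand w u u<N) ⟩
  ∑< N (λ w → ∑< N λ u → ∑< N λ d → ∑< N λ q → term w d q u)
    ≡⟨ ∑<-cong N (λ w _ → trans (∑<-comm N N _) (∑<-cong N λ d _ → ∑<-comm N N _)) ⟩
  ∑< N (λ w → ∑< N λ d → ∑< N λ q → ∑< N λ u → term w d q u)
    ≡⟨ ∑<-cong N (λ w _ → ∑<-cong N λ d _ → ∑<-cong N λ q _ → collapse w d q) ⟩
  ∑< N (λ w → ∑< N λ d → ∑< N λ q →
    δ (suc d ℕ.* suc q ℕ.* suc w) N * (f (suc d) * g (suc q) * h (suc w))) ∎
  where
  N = suc n

  term : ℕ → ℕ → ℕ → ℕ → ℤ
  term w d q u = δ (suc u ℕ.* suc w) N * (δ (suc d ℕ.* suc q) (suc u) * (f (suc d) * g (suc q) * h (suc w)))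

  rearrange₁ : ∀ a b c → a * (b * c) ≡ a * c * b
  rearrange₁ = solve-∀

  rearrange₂ : ∀ a b c d → a * b * (c * d) ≡ a * (c * (d * b))
  rearrange₂ = solve-∀

  expand : ∀ w u → u < N → δ (suc u ℕ.* suc w) N * ((f ⋆ g) (suc u) * h (suc w)) ≡
           ∑< N λ d → ∑< N λ q → term w d q u
  expand w u u<N = begin
    x * ((f ⋆ g) (suc u) * y)
      ≡⟨ cong (λ z → x * (z * y)) (⋆-∑∑ f g u u<N) ⟩
    x * (∑< N (λ d → ∑< N (t d)) * y)
      ≡⟨ rearrange₁ x _ y ⟩
    x * y * ∑< N (λ d → ∑< N (t d))
      ≡⟨ ∑<-distribˡ-* N (x * y) _ ⟩
    ∑< N (λ d → x * y * ∑< N (t d))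
      ≡⟨ ∑<-cong N (λ d _ → trans (∑<-distribˡ-* N (x * y) (t d)) (∑<-cong N λ q _ →
           rearrange₂ x y (δ (suc d ℕ.* suc q) (suc u)) (f (suc d) * g (suc q)))) ⟩
    ∑< N (λ d → ∑< N λ q → term w d q u) ∎
    where
    x = δ (suc u ℕ.* suc w) N
    y = h (suc w)
    t : ℕ → ℕ → ℤ
    t d q = δ (suc d ℕ.* suc q) (suc u) * (f (suc d) * g (suc q))

  collapse : ∀ w d q → ∑< N (term w d q) ≡
    δ (suc d ℕ.* suc q ℕ.* suc w) N * (f (suc d) * g (suc q) * h (suc w))
  -- `q + d * suc q` is the predecessor of `suc d * suc q`, the only `u` at which the inner `δ`
  -- survives. If it is out of range, the outer `δ` is zero as well.
  collapse w d q with (q ℕ.+ d ℕ.* suc q) ℕ.<? N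
  ... | yes v<N = begin
    ∑< N (term w d q)
      ≡⟨ ∑<-only N (term w d q) v<N (λ u u≢v →
           trans (cong (_*_ (δ (suc u ℕ.* suc w) N)) (δ-≢ _ λ v≡u → u≢v (sym (ℕₚ.suc-injective v≡u))))
                 (ℤₚ.*-zeroʳ (δ (suc u ℕ.* suc w) N))) ⟩
    term w d q (q ℕ.+ d ℕ.* suc q)
      ≡⟨ cong (_*_ (δ (suc d ℕ.* suc q ℕ.* suc w) N)) (δ-≡ _ refl) ⟩
    _ ∎
  ... | no v≮N = trans
    (∑<-zero N (term w d q) λ u u<N →
      trans (cong (_*_ (δ (suc u ℕ.* suc w) N)) (δ-≢ _ λ v≡u →
              v≮N (subst (_< N) (sym (ℕₚ.suc-injective v≡u)) u<N)))
            (ℤₚ.*-zeroʳ (δ (suc u ℕ.* suc w) N)))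
    (sym (δ-≢ _ λ vw≡N → v≮N
      (subst (suc d ℕ.* suc q ≤_) vw≡N (ℕₚ.m≤m*n (suc d ℕ.* suc q) (suc w)))))

-- The triple sum is invariant under cyclic rotation, which turns `(f ⋆ g) ⋆ h` into `(g ⋆ h) ⋆ f`;
-- commutativity does the rest.
⋆-assoc : ∀ f g h → (f ⋆ g) ⋆ h ≈ f ⋆ (g ⋆ h)
⋆-assoc f g h n = begin
  ((f ⋆ g) ⋆ h) (suc n)
    ≡⟨ ⋆-∑∑∑ f g h n ⟩
  ∑< N (λ c → ∑< N λ a → ∑< N λ b →
    δ (suc a ℕ.* suc b ℕ.* suc c) N * (f (suc a) * g (suc b) * h (suc c)))
    ≡⟨ ∑<-comm N N _ ⟩
  ∑< N (λ a → ∑< N λ c → ∑< N λ b →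
    δ (suc a ℕ.* suc b ℕ.* suc c) N * (f (suc a) * g (suc b) * h (suc c)))
    ≡⟨ ∑<-cong N (λ a _ → ∑<-comm N N _) ⟩
  ∑< N (λ a → ∑< N λ b → ∑< N λ c →
    δ (suc a ℕ.* suc b ℕ.* suc c) N * (f (suc a) * g (suc b) * h (suc c)))
    ≡⟨ ∑<-cong N (λ a _ → ∑<-cong N λ b _ → ∑<-cong N λ c _ → cong₂ _*_
         (cong (λ m → δ m N) (trans (ℕₚ.*-assoc (suc a) (suc b) (suc c)) (ℕₚ.*-comm (suc a) (suc b ℕ.* suc c))))
         (trans (ℤₚ.*-assoc (f (suc a)) (g (suc b)) (h (suc c))) (ℤₚ.*-comm (f (suc a)) (g (suc b) * h (suc c))))) ⟩
  ∑< N (λ a → ∑< N λ b → ∑< N λ c →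
    δ (suc b ℕ.* suc c ℕ.* suc a) N * (g (suc b) * h (suc c) * f (suc a)))
    ≡⟨ ⋆-∑∑∑ g h f n ⟨
  ((g ⋆ h) ⋆ f) (suc n)
    ≡⟨ ⋆-comm (g ⋆ h) f n ⟩
  (f ⋆ (g ⋆ h)) (suc n) ∎
  where N = suc n

-- Convolution with it is dilation by `p`: `g` becomes `n ↦ g (n / p)` on multiples of `p` and zero
-- elsewhere.
𝟏[_] : ℕ → ArithFun
𝟏[ p ] n = δ n p

𝟏[]-⋆-* : ∀ g p q n → suc p ℕ.* suc q ≡ suc n → (𝟏[ suc p ] ⋆ g) (suc n) ≡ g (suc q)
𝟏[]-⋆-* g p q n pq≡n = begin
  (𝟏[ suc p ] ⋆ g) N ≡⟨ ⋆-∑∑ 𝟏[ suc p ] g n ℕₚ.≤-refl ⟩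
  ∑< N (λ d → ∑< N (t d)) ≡⟨ ∑<-only N _ p<N (λ d d≢p → ∑<-zero N (t d) λ i _ → trans
                               (cong (_*_ (δ (suc d ℕ.* suc i) N)) (δ-≢ _ (d≢p ∘ ℕₚ.suc-injective)))
                               (ℤₚ.*-zeroʳ (δ (suc d ℕ.* suc i) N))) ⟩
  ∑< N (t p)              ≡⟨ ∑<-only N (t p) q<N (λ i i≢q → δ-≢ _ λ pi≡n →
                               i≢q (ℕₚ.suc-injective (ℕₚ.*-cancelˡ-≡ _ _ (suc p) (trans pi≡n (sym pq≡n))))) ⟩
  t p q                   ≡⟨ δ-≡ _ pq≡n ⟩
  δ (suc p) (suc p) * g (suc q) ≡⟨ δ-≡ _ refl ⟩
  g (suc q)               ∎
  where
  N = suc n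
  t : ℕ → ℕ → ℤ
  t d i = δ (suc d ℕ.* suc i) N * (δ (suc d) (suc p) * g (suc i))
  p<N : p < N
  p<N = subst (p <_) pq≡n (ℕₚ.m≤m*n (suc p) (suc q))
  q<N : q < N
  q<N = subst (q <_) pq≡n (ℕₚ.m≤n*m (suc q) (suc p))

𝟏[]-⋆-∤ : ∀ g p n → ¬ (p ∣ suc n) → (𝟏[ p ] ⋆ g) (suc n) ≡ + 0
𝟏[]-⋆-∤ g p n p∤n = ⋆-vanish n λ d q dq≡n → δ-≢ _ λ d≡p →
  p∤n (subst (_∣ suc n) d≡p (subst (suc d ∣_) dq≡n (m∣m*n (suc q))))

e≈𝟏[1] : e ≈ 𝟏[ 1 ]
e≈𝟏[1] zero    = trans (sym (δ-≡ (+ 1) refl)) (ℤₚ.*-identityʳ (δ 1 1))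
e≈𝟏[1] (suc n) = trans (sym (δ-≢ {suc (suc n)} {1} (+ 1) λ ())) (ℤₚ.*-identityʳ (δ (suc (suc n)) 1))

⋆-identityˡ : ∀ g → e ⋆ g ≈ g
⋆-identityˡ g n = trans (⋆-cong {g = g} e≈𝟏[1] (λ _ → refl) n) (𝟏[]-⋆-* g 0 n n (ℕₚ.*-identityˡ (suc n)))

⋆-e-commutativeMonoid : CommutativeMonoid _ _
⋆-e-commutativeMonoid = record
  { Carrier = ArithFun
  ; _≈_     = _≈_
  ; _∙_     = _⋆_
  ; ε       = e
  ; isCommutativeMonoid = record
    { isMonoid = record
      { isSemigroup = record
        { isMagma = record { isEquivalence = ≈-isEquivalence ; ∙-cong = λ {f} {f′} {g} {g′} → ⋆-cong {f} {f′} {g} {g′} }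
        ; assoc   = ⋆-assoc
        }
      ; identity = ⋆-identityˡ , λ g n → trans (⋆-comm g e n) (⋆-identityˡ g n)
      }
    ; comm = ⋆-comm
    }
  }

open import Algebra.Properties.CommutativeSemigroup (CommutativeMonoid.commutativeSemigroup ⋆-e-commutativeMonoid)
  using (interchange; x∙yz≈z∙yx; x∙yz≈y∙xz)

-- Möbius inversion

μaux-one : ∀ k d → μaux k 1 (suc d) ≡ + 1
μaux-one zero    d = refl
μaux-one (suc k) d = refl

μaux-skip : ∀ k n d → ¬ (suc d ∣ n) → μaux (suc k) n (suc d) ≡ μaux k n (suc (suc d))
μaux-skip k zero          d d∤n = contradiction (suc d ∣0) d∤n
μaux-skip k (suc zero)    d d∤n = sym (μaux-one k (suc d))
μaux-skip k (suc (suc n)) d d∤n with suc d ∣? suc (suc n)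
... | yes d∣n = contradiction d∣n d∤n
... | no  _   = refl

μaux-square : ∀ k n d → suc (suc d) ℕ.* suc (suc d) ∣ suc n → μaux (suc k) (suc n) (suc (suc d)) ≡ + 0
μaux-square k zero    d d²∣n = contradiction (∣1⇒≡1 d²∣n) λ ()
μaux-square k (suc n) d d²∣n with suc (suc d) ∣? suc (suc n)
... | no  d∤n = contradiction (∣-trans (m∣m*n (suc (suc d))) d²∣n) d∤n
... | yes _ with suc (suc d) ℕ.* suc (suc d) ∣? suc (suc n)
...   | yes _    = refl
...   | no d²∤n = contradiction d²∣n d²∤n

μaux-strip : ∀ k n d → suc (suc d) ∣ suc n → ¬ (suc (suc d) ℕ.* suc (suc d) ∣ suc n) →
             μaux (suc k) (suc n) (suc (suc d)) ≡ - μaux k (suc n / suc (suc d)) (suc (suc (suc d)))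
μaux-strip k zero    d d∣n d²∤n = contradiction (∣1⇒≡1 d∣n) λ ()
μaux-strip k (suc n) d d∣n d²∤n with suc (suc d) ∣? suc (suc n)
... | no  d∤n = contradiction d∣n d∤n
... | yes _ with suc (suc d) ℕ.* suc (suc d) ∣? suc (suc n)
...   | yes d²∣n = contradiction d²∣n d²∤n
...   | no _     = refl

μaux-strip-* : ∀ k n u d → n ≡ suc u ℕ.* suc (suc d) → ¬ (suc (suc d) ∣ suc u) →
               μaux (suc k) n (suc (suc d)) ≡ - μaux k (suc u) (suc (suc (suc d)))
μaux-strip-* k n u d refl d∤u = trans
  (μaux-strip k (suc d ℕ.+ u ℕ.* D) d (divides (suc u) refl) (d∤u ∘ *-cancelʳ-∣ D))
  (cong (λ m → - μaux k m (suc D)) (m*n/n≡m (suc u) D))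
  where D = suc (suc d)

-- The three ways in which `μaux` treats a trial divisor. In `strips`, `suc u` is the cofactor with
-- which the recursion continues.
data TrialDivision (n d : ℕ) : Set where
  skips   : ¬ (d ∣ n) → TrialDivision n d
  squares : d ℕ.* d ∣ n → TrialDivision n d
  strips  : ∀ u → n ≡ suc u ℕ.* d → ¬ (d ∣ suc u) → TrialDivision n d

trialDivision : ∀ n d → TrialDivision (suc n) (suc d)
trialDivision n d with suc d ∣? suc n
... | no d∤n = skips d∤n
... | yes (divides (suc u) n≡ud) with suc d ∣? suc u
...   | no d∤u = strips u n≡ud d∤u
...   | yes d∣u = squares (subst (suc d ℕ.* suc d ∣_) (sym n≡ud) (*-monoˡ-∣ (suc d) d∣u))

-- Fuel plus trial divisor is constant along the recursion while the cofactor never grows. When the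
-- fuel runs out, the trial divisor exceeds the cofactor, so one more step could only skip.
μaux-fuel-suc : ∀ k n d → suc n < k ℕ.+ suc (suc d) →
                μaux (suc k) (suc n) (suc (suc d)) ≡ μaux k (suc n) (suc (suc d))
μaux-fuel-suc zero n d n<d = μaux-skip 0 (suc n) (suc d) λ d∣n → ℕₚ.<⇒≱ n<d (∣⇒≤ d∣n)
μaux-fuel-suc (suc k) n d n<k+d with trialDivision n (suc d)
... | skips d∤n = begin
  _ ≡⟨ μaux-skip (suc k) (suc n) (suc d) d∤n ⟩
  _ ≡⟨ μaux-fuel-suc k n (suc d) (subst (suc n <_) (sym (ℕₚ.+-suc k _)) n<k+d) ⟩
  _ ≡⟨ μaux-skip k (suc n) (suc d) d∤n ⟨
  _ ∎
... | squares d²∣n = trans (μaux-square (suc k) n d d²∣n) (sym (μaux-square k n d d²∣n))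
... | strips u n≡ud d∤u = begin
  _ ≡⟨ μaux-strip-* (suc k) (suc n) u d n≡ud d∤u ⟩
  _ ≡⟨ cong -_ (μaux-fuel-suc k u (suc d) (ℕₚ.≤-<-trans
         (subst (suc u ≤_) (sym n≡ud) (ℕₚ.m≤m*n (suc u) (suc (suc d))))
         (subst (suc n <_) (sym (ℕₚ.+-suc k _)) n<k+d))) ⟩
  _ ≡⟨ μaux-strip-* k (suc n) u d n≡ud d∤u ⟨
  _ ∎

-- `μ (p * t)` and `μ t` start with different fuel; this makes the two runs comparable.
μaux-fuel : ∀ j n → μaux (j ℕ.+ suc n) (suc n) 2 ≡ μ (suc n)
μaux-fuel zero    n = refl
μaux-fuel (suc j) n = trans
  (μaux-fuel-suc (j ℕ.+ suc n) n 0 (ℕₚ.≤-<-trans (ℕₚ.m≤n+m (suc n) j) (ℕₚ.m<m+n (j ℕ.+ suc n) (s≤s z≤n))))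
  (μaux-fuel j n)

-- A positive number below a prime is coprime to it.
coprime-∤ : ∀ {p d t} → Prime p → suc d < p → ¬ (suc d ∣ t) → ¬ (suc d ∣ p ℕ.* t)
coprime-∤ p-prime d<p d∤t d∣pt = d∤t (coprime-divisor (coprime-sym (prime⇒coprime p-prime d<p)) d∣pt)

-- The trial divisions of `p * t` and `t` run in parallel. Below `p` they take the same branch; at
-- `p` the first strips, which gives the sign, and the second skips; from there on they coincide.
μaux-prime-* : ∀ {p} → Prime p → ∀ k t d → suc (suc d) ≤ p → ¬ (p ∣ suc t) → p ℕ.* suc t < k ℕ.+ suc (suc d) →
               μaux k (p ℕ.* suc t) (suc (suc d)) ≡ - μaux k (suc t) (suc (suc d))
μaux-prime-* {p} p-prime zero t d d≤p p∤t pt<d =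
  contradiction (ℕₚ.≤-trans pt<d d≤p) (ℕₚ.≤⇒≯ (ℕₚ.m≤m*n p (suc t)))
μaux-prime-* {p} p-prime (suc k) t d d≤p p∤t pt<k+d with suc (suc d) ℕ.≟ p
... | yes refl = begin
  _ ≡⟨ μaux-strip-* k _ t d (ℕₚ.*-comm (suc (suc d)) (suc t)) p∤t ⟩
  _ ≡⟨ cong -_ (μaux-skip k (suc t) (suc d) p∤t) ⟨
  _ ∎
... | no d≢p with ℕₚ.≤∧≢⇒< d≤p d≢p | subst (p ℕ.* suc t <_) (sym (ℕₚ.+-suc k _)) pt<k+d | trialDivision t (suc d)
...   | d<p | fuel | skips d∤t = begin
  _ ≡⟨ μaux-skip k _ (suc d) (coprime-∤ p-prime d<p d∤t) ⟩
  _ ≡⟨ μaux-prime-* p-prime k t (suc d) d<p p∤t fuel ⟩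
  _ ≡⟨ cong -_ (μaux-skip k (suc t) (suc d) d∤t) ⟨
  _ ∎
-- With `p` exposed as a successor, `p * suc t` computes to the successor that `μaux-square`
-- expects.
...   | d<p | fuel | squares d²∣t with p
...     | suc p′ = trans (μaux-square k (t ℕ.+ p′ ℕ.* suc t) d (∣n⇒∣m*n (suc p′) d²∣t))
                         (cong -_ (sym (μaux-square k t d d²∣t)))
μaux-prime-* {p} p-prime (suc k) t d d≤p p∤t pt<k+d | no d≢p | d<p | fuel | strips u t≡ud d∤u with p
... | suc p′ = begin
  _ ≡⟨ μaux-strip-* k _ (u ℕ.+ p′ ℕ.* suc u) d
         (trans (cong (suc p′ ℕ.*_) t≡ud) (sym (ℕₚ.*-assoc (suc p′) (suc u) D)))
         (coprime-∤ p-prime d<p d∤u) ⟩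
  _ ≡⟨ cong -_ (μaux-prime-* p-prime k u (suc d) d<p
         (λ p∣u → p∤t (subst (suc p′ ∣_) (sym t≡ud) (∣m⇒∣m*n D p∣u)))
         (ℕₚ.≤-<-trans (ℕₚ.*-monoʳ-≤ (suc p′) (subst (suc u ≤_) (sym t≡ud) (ℕₚ.m≤m*n (suc u) D))) fuel)) ⟩
  _ ≡⟨ cong -_ (μaux-strip-* k (suc t) u d t≡ud d∤u) ⟨
  _ ∎
  where D = suc (suc d)

-- Trial divisors below `p` leave the factor `p * p` untouched, so the square test fires at `p` at
-- the latest.
μaux-prime-square : ∀ {p} → Prime p → ∀ k t d → suc (suc d) ≤ p → p ℕ.* (p ℕ.* suc t) < k ℕ.+ suc (suc d) →
                    μaux k (p ℕ.* (p ℕ.* suc t)) (suc (suc d)) ≡ + 0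
μaux-prime-square {suc p} p-prime zero t d d≤p ppt<d =
  contradiction (ℕₚ.≤-trans ppt<d d≤p) (ℕₚ.≤⇒≯ (ℕₚ.m≤m*n (suc p) (suc p ℕ.* suc t)))
μaux-prime-square {suc p} p-prime (suc k) t d d≤p ppt<k+d with suc (suc d) ℕ.≟ suc p
... | yes refl = μaux-square k _ d (subst (suc p ℕ.* suc p ∣_) (ℕₚ.*-assoc (suc p) (suc p) (suc t)) (m∣m*n (suc t)))
... | no d≢p with ℕₚ.≤∧≢⇒< d≤p d≢p | subst (suc p ℕ.* (suc p ℕ.* suc t) <_) (sym (ℕₚ.+-suc k _)) ppt<k+d | trialDivision t (suc d)
...   | d<p | fuel | skips d∤t = trans
  (μaux-skip k _ (suc d) (coprime-∤ p-prime d<p (coprime-∤ p-prime d<p d∤t)))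
  (μaux-prime-square p-prime k t (suc d) d<p fuel)
...   | d<p | fuel | squares d²∣t = μaux-square k _ d (∣n⇒∣m*n (suc p) (∣n⇒∣m*n (suc p) d²∣t))
...   | d<p | fuel | strips u t≡ud d∤u = trans
  (μaux-strip-* k _ _ d
    (trans (cong (λ x → suc p ℕ.* (suc p ℕ.* x)) t≡ud)
      (trans (cong (suc p ℕ.*_) (sym (ℕₚ.*-assoc (suc p) (suc u) D))) (sym (ℕₚ.*-assoc (suc p) (suc p ℕ.* suc u) D))))
    (coprime-∤ p-prime d<p (coprime-∤ p-prime d<p d∤u)))
  (cong -_ (μaux-prime-square p-prime k u (suc d) d<p
    (ℕₚ.≤-<-trans (ℕₚ.*-monoʳ-≤ (suc p) (ℕₚ.*-monoʳ-≤ (suc p)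
      (subst (suc u ≤_) (sym t≡ud) (ℕₚ.m≤m*n (suc u) D)))) fuel)))
  where D = suc (suc d)

μ-prime-* : ∀ {p} → Prime p → ∀ t → ¬ (p ∣ suc t) → μ (p ℕ.* suc t) ≡ - μ (suc t)
μ-prime-* {suc zero}    p-prime t p∤t = contradiction (divides (suc t) (sym (ℕₚ.*-identityʳ (suc t)))) p∤t
μ-prime-* {suc (suc p)} p-prime t p∤t = trans
  (μaux-prime-* p-prime n t 0 (s≤s (s≤s z≤n)) p∤t (ℕₚ.m<m+n n (s≤s z≤n)))
  (cong -_ (trans (cong (λ k → μaux k (suc t) 2) (ℕₚ.+-comm (suc t) (suc p ℕ.* suc t)))
                  (μaux-fuel (suc p ℕ.* suc t) t)))
  where n = suc (suc p) ℕ.* suc t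

μ-prime-square : ∀ {p} → Prime p → ∀ t → μ (p ℕ.* (p ℕ.* suc t)) ≡ + 0
μ-prime-square {p} p-prime t = μaux-prime-square p-prime (p ℕ.* (p ℕ.* suc t)) t 0
  (ℕ.nonTrivial⇒n>1 p {{prime⇒nonTrivial p-prime}}) (ℕₚ.m<m+n _ (s≤s z≤n))

prime-divisor : ∀ n → ∃ λ p → Prime p × p ∣ suc (suc n)
prime-divisor n with factorise (suc (suc n))
... | record { factors = [] ; isFactorisation = () }
... | record { factors = p ∷ ps ; isFactorisation = n≡Π ; factorsPrime = p-prime ∷ _ } =
  p , p-prime , subst (p ∣_) (sym n≡Π) (m∣m*n (product ps))

opaque
  _∤only_ : ℕ → ArithFun → ArithFun
  (p ∤only f) n = ⟦ ¬? (p ∣? n) ⟧ * f n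

  ∤only-∣ : ∀ {p n} f → p ∣ n → (p ∤only f) n ≡ + 0
  ∤only-∣ {p} {n} f p∣n = ⟦⟧-*-zero (¬? (p ∣? n)) (f n) (contradiction p∣n)

  ∤only-∤ : ∀ {p n} f → ¬ (p ∣ n) → (p ∤only f) n ≡ f n
  ∤only-∤ {p} {n} f p∤n = ⟦⟧-*-one (¬? (p ∣? n)) (f n) p∤n

-- The Euler factor of `μ` at `p`. The cases are `p` not dividing `n`, `p` dividing `n` exactly once
-- (a sign), and `p * p` dividing `n` (both sides zero).
μ-split : ∀ {p} → Prime p → μ ≈ λ n → (p ∤only μ) n + - + 1 * (𝟏[ p ] ⋆ (p ∤only μ)) n
μ-split {suc p} p-prime n with suc p ∣? suc n
... | no p∤n = sym (trans (cong₂ _+_ (∤only-∤ μ p∤n) (cong (_*_ (- + 1)) (𝟏[]-⋆-∤ _ (suc p) n p∤n)))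
                          (ℤₚ.+-identityʳ _))
... | yes p∣n@(divides (suc q) n≡qp) = begin
  μ (suc n)                       ≡⟨ cong μ (sym pq≡n) ⟩
  μ (suc p ℕ.* suc q)             ≡⟨ μ-multiple ⟩
  - + 1 * (suc p ∤only μ) (suc q) ≡⟨ ℤₚ.+-identityˡ _ ⟨
  + 0 + - + 1 * (suc p ∤only μ) (suc q)
    ≡⟨ cong₂ _+_ (∤only-∣ μ p∣n) (cong (_*_ (- + 1)) (𝟏[]-⋆-* _ p q n pq≡n)) ⟨
  _ ∎
  where
  pq≡n : suc p ℕ.* suc q ≡ suc n
  pq≡n = trans (ℕₚ.*-comm (suc p) (suc q)) (sym n≡qp)

  μ-multiple : μ (suc p ℕ.* suc q) ≡ - + 1 * (suc p ∤only μ) (suc q)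
  μ-multiple with suc p ∣? suc q
  ... | no p∤q = trans (μ-prime-* p-prime q p∤q)
                   (trans (sym (ℤₚ.-1*i≡-i (μ (suc q)))) (cong (_*_ (- + 1)) (sym (∤only-∤ μ p∤q))))
  ... | yes p∣q@(divides (suc r) q≡rp) = trans
    (cong (λ x → μ (suc p ℕ.* x)) (trans q≡rp (ℕₚ.*-comm (suc r) (suc p))))
    (trans (μ-prime-square p-prime r) (cong (_*_ (- + 1)) (sym (∤only-∣ μ p∣q))))

𝟙-split : ∀ p → 𝟙 ≈ λ n → (suc p ∤only 𝟙) n + (𝟏[ suc p ] ⋆ 𝟙) n
𝟙-split p n with suc p ∣? suc n
... | no p∤n = sym (cong₂ _+_ (∤only-∤ 𝟙 p∤n) (𝟏[]-⋆-∤ 𝟙 (suc p) n p∤n))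
... | yes p∣n@(divides (suc q) n≡qp) =
  sym (cong₂ _+_ (∤only-∣ 𝟙 p∣n) (𝟏[]-⋆-* 𝟙 p q n (trans (ℕₚ.*-comm (suc p) (suc q)) (sym n≡qp))))

∤only-⋆-∤only : ∀ {p} → Prime p → ∀ f g {n} → p ∣ suc n → ((p ∤only f) ⋆ (p ∤only g)) (suc n) ≡ + 0
∤only-⋆-∤only {p} p-prime f g {n} p∣n = ⋆-vanish n vanishes
  where
  vanishes : ∀ d q → suc d ℕ.* suc q ≡ suc n → (p ∤only f) (suc d) * (p ∤only g) (suc q) ≡ + 0
  vanishes d q dq≡n with euclidsLemma (suc d) (suc q) p-prime (subst (p ∣_) (sym dq≡n) p∣n)
  ... | inj₁ p∣d = cong (_* (p ∤only g) (suc q)) (∤only-∣ f p∣d)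
  ... | inj₂ p∣q = trans (cong (_*_ ((p ∤only f) (suc d))) (∤only-∣ g p∣q)) (ℤₚ.*-zeroʳ ((p ∤only f) (suc d)))

-- For a prime p dividing n, let μ′ and χ be μ and 𝟙 made zero at the multiples of p.  Then μ = (e − 𝟏[p]) ⋆ μ′ and
-- (e − 𝟏[p]) ⋆ 𝟙 = χ, so (μ ⋆ 𝟙)(n) = (μ′ ⋆ χ)(n), which vanishes as p ∣ n.
𝟙⋆μ≈e : 𝟙 ⋆ μ ≈ e
𝟙⋆μ≈e zero = refl
𝟙⋆μ≈e (suc n) with prime-divisor n
... | zero , p-prime , p∣n = contradiction p-prime ¬prime[0]
... | p@(suc p′) , p-prime , p∣n = begin
  (𝟙 ⋆ μ) N
    ≡⟨ ⋆-cong {𝟙} (λ _ → refl) (μ-split p-prime) (suc n) ⟩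
  (𝟙 ⋆ (λ k → μ′ k + - + 1 * (𝟏[ p ] ⋆ μ′) k)) N
    ≡⟨ ⋆-distribˡ-+ 𝟙 μ′ (λ k → - + 1 * (𝟏[ p ] ⋆ μ′) k) N ⟩
  (𝟙 ⋆ μ′) N + (𝟙 ⋆ (λ k → - + 1 * (𝟏[ p ] ⋆ μ′) k)) N
    ≡⟨ cong₂ _+_ 𝟙⋆μ′ (⋆-*ʳ (- + 1) 𝟙 (𝟏[ p ] ⋆ μ′) N) ⟩
  (+ 0 + (μ′ ⋆ (𝟏[ p ] ⋆ 𝟙)) N) + - + 1 * (𝟙 ⋆ (𝟏[ p ] ⋆ μ′)) N
    ≡⟨ cong (λ x → (+ 0 + (μ′ ⋆ (𝟏[ p ] ⋆ 𝟙)) N) + - + 1 * x) rotate ⟩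
  (+ 0 + (μ′ ⋆ (𝟏[ p ] ⋆ 𝟙)) N) + - + 1 * (μ′ ⋆ (𝟏[ p ] ⋆ 𝟙)) N
    ≡⟨ cancel ((μ′ ⋆ (𝟏[ p ] ⋆ 𝟙)) N) ⟩
  + 0 ∎
  where
  N = suc (suc n)
  μ′ = p ∤only μ

  cancel : ∀ x → (+ 0 + x) + - + 1 * x ≡ + 0
  cancel = solve-∀

  𝟙⋆μ′ : (𝟙 ⋆ μ′) N ≡ + 0 + (μ′ ⋆ (𝟏[ p ] ⋆ 𝟙)) N
  𝟙⋆μ′ = begin
    (𝟙 ⋆ μ′) N                                         ≡⟨ ⋆-comm 𝟙 μ′ (suc n) ⟩
    (μ′ ⋆ 𝟙) N                                         ≡⟨ ⋆-cong {μ′} (λ _ → refl) (𝟙-split p′) (suc n) ⟩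
    (μ′ ⋆ (λ k → (p ∤only 𝟙) k + (𝟏[ p ] ⋆ 𝟙) k)) N    ≡⟨ ⋆-distribˡ-+ μ′ (p ∤only 𝟙) (𝟏[ p ] ⋆ 𝟙) N ⟩
    (μ′ ⋆ (p ∤only 𝟙)) N + (μ′ ⋆ (𝟏[ p ] ⋆ 𝟙)) N       ≡⟨ cong (_+ (μ′ ⋆ (𝟏[ p ] ⋆ 𝟙)) N) (∤only-⋆-∤only p-prime μ 𝟙 p∣n) ⟩
    + 0 + (μ′ ⋆ (𝟏[ p ] ⋆ 𝟙)) N                        ∎

  rotate : (𝟙 ⋆ (𝟏[ p ] ⋆ μ′)) N ≡ (μ′ ⋆ (𝟏[ p ] ⋆ 𝟙)) N
  rotate = x∙yz≈z∙yx 𝟙 𝟏[ p ] μ′ (suc n)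

-- Powers of 𝟙 − e convolved with powers of μ, and their generating sums

𝟙−e : ArithFun
𝟙−e n = 𝟙 n - e n

𝟙−e⋆μ : ArithFun
𝟙−e⋆μ = 𝟙−e ⋆ μ

c-zero : c 0 ≈ e
c-zero = ⋆-identityˡ e

c-suc : ∀ i → c (suc i) ≈ 𝟙−e⋆μ ⋆ c i
c-suc i = interchange 𝟙−e (𝟙−e ^⋆ i) μ (μ ^⋆ i)

-- `𝟙−e⋆μ` is zero at `1`, so each of the `i` factors in a nonzero term is at least `2` and lowers
-- the remaining cofactor by at least one. This crude bound is enough for every truncation below.
c-vanish : ∀ i {n} → 1 ≤ n → n ≤ i → c i n ≡ + 0
c-vanish (suc i) {suc n} _ (s≤s n≤i) = trans (c-suc i n) (⋆-vanish n term)
  where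
  term : ∀ d q → suc d ℕ.* suc q ≡ suc n → 𝟙−e⋆μ (suc d) * c i (suc q) ≡ + 0
  term zero    q _    = refl
  term (suc d) q dq≡n = trans
    (cong (_*_ (𝟙−e⋆μ (suc (suc d)))) (c-vanish i (s≤s z≤n)
      (ℕₚ.≤-trans (ℕ.s≤s⁻¹ (subst (suc q <_) dq≡n (ℕₚ.m<m+n (suc q) (s≤s z≤n)))) n≤i)))
    (ℤₚ.*-zeroʳ (𝟙−e⋆μ (suc (suc d))))

-- Convolve h = 𝟙−e⋆μ ⋆ g with 𝟙 = e + 𝟙−e to get 𝟙−e ⋆ g = h + 𝟙−e ⋆ h.
𝟙−e⋆μ-fixpoint : ∀ g → 𝟙−e⋆μ ⋆ g ≈ 𝟙−e ⋆ (λ n → g n + - + 1 * (𝟙−e⋆μ ⋆ g) n)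
𝟙−e⋆μ-fixpoint g n = sym (begin
  (𝟙−e ⋆ (λ k → g k + - + 1 * h k)) N       ≡⟨ ⋆-distribˡ-+ 𝟙−e g (λ k → - + 1 * h k) N ⟩
  (𝟙−e ⋆ g) N + (𝟙−e ⋆ (λ k → - + 1 * h k)) N ≡⟨ cong₂ _+_ 𝟙−e⋆g (⋆-*ʳ (- + 1) 𝟙−e h N) ⟩
  (h N + (𝟙−e ⋆ h) N) + - + 1 * (𝟙−e ⋆ h) N ≡⟨ cancel (h N) ((𝟙−e ⋆ h) N) ⟩
  h N                                       ∎)
  where
  N = suc n
  h = 𝟙−e⋆μ ⋆ g

  cancel : ∀ x y → (x + y) + - + 1 * y ≡ x
  cancel = solve-∀

  split : ∀ x y → x ≡ y + (x - y)
  split = solve-∀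

  𝟙⋆𝟙−e⋆μ : 𝟙 ⋆ 𝟙−e⋆μ ≈ 𝟙−e
  𝟙⋆𝟙−e⋆μ k = begin
    (𝟙 ⋆ (𝟙−e ⋆ μ)) (suc k) ≡⟨ x∙yz≈y∙xz 𝟙 𝟙−e μ k ⟩
    (𝟙−e ⋆ (𝟙 ⋆ μ)) (suc k) ≡⟨ ⋆-cong {𝟙−e} (λ _ → refl) 𝟙⋆μ≈e k ⟩
    (𝟙−e ⋆ e) (suc k)       ≡⟨ ⋆-comm 𝟙−e e k ⟩
    (e ⋆ 𝟙−e) (suc k)       ≡⟨ ⋆-identityˡ 𝟙−e k ⟩
    𝟙−e (suc k)             ∎

  𝟙−e⋆g : (𝟙−e ⋆ g) N ≡ h N + (𝟙−e ⋆ h) N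
  𝟙−e⋆g = begin
    (𝟙−e ⋆ g) N                     ≡⟨ ⋆-cong {g = g} 𝟙⋆𝟙−e⋆μ (λ _ → refl) n ⟨
    ((𝟙 ⋆ 𝟙−e⋆μ) ⋆ g) N             ≡⟨ ⋆-assoc 𝟙 𝟙−e⋆μ g n ⟩
    (𝟙 ⋆ h) N                       ≡⟨ ⋆-comm 𝟙 h n ⟩
    (h ⋆ 𝟙) N                       ≡⟨ ⋆-cong {h} (λ _ → refl) (λ k → split (+ 1) (e (suc k))) n ⟩
    (h ⋆ (λ k → e k + 𝟙−e k)) N     ≡⟨ ⋆-distribˡ-+ h e 𝟙−e N ⟩
    (h ⋆ e) N + (h ⋆ 𝟙−e) N         ≡⟨ cong₂ _+_ (trans (⋆-comm h e n) (⋆-identityˡ h n)) (⋆-comm h 𝟙−e n) ⟩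
    h N + (𝟙−e ⋆ h) N               ∎

-- The number of multisets of size `i` from `s` kinds, given by Pascal's rule to avoid division and
-- truncated subtraction.
multichoose : ℕ → ℕ → ℕ
multichoose s       zero    = 1
multichoose zero    (suc i) = 0
multichoose (suc s) (suc i) = multichoose s (suc i) ℕ.+ multichoose (suc s) i

-- Coefficientwise form of `(1 − y)⁻⁽ˢ⁺¹⁾ = (1 − y)⁻ˢ + y (1 − y)⁻⁽ˢ⁺¹⁾`, which is Pascal's rule.
-- The condition on `t n` covers the end term of the shifted sum.
∑<-multichoose : ∀ s n (t : ℕ → ℤ) → t n ≡ + 0 →
  ∑< n (λ i → + multichoose (suc s) i * t i) ≡
  ∑< n (λ i → + multichoose s i * t i) + ∑< n (λ i → + multichoose (suc s) i * t (suc i))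
∑<-multichoose s n t tn≡0 = begin
  ∑< n (λ i → + multichoose (suc s) i * t i)
    ≡⟨ extend (suc s) ⟩
  ∑< (suc n) (λ i → + multichoose (suc s) i * t i)
    ≡⟨ ∑<-first n _ ⟩
  + 1 * t 0 + ∑< n (λ i → + multichoose (suc s) (suc i) * t (suc i))
    ≡⟨ cong (_+_ (+ 1 * t 0)) (trans (∑<-cong n λ i _ → ℤₚ.*-distribʳ-+ (t (suc i)) (+ multichoose s (suc i)) (+ multichoose (suc s) i))
         (∑<-distrib-+ n _ _)) ⟩
  + 1 * t 0 + (∑< n (λ i → + multichoose s (suc i) * t (suc i)) + shifted)
    ≡⟨ ℤₚ.+-assoc (+ 1 * t 0) _ shifted ⟨
  (+ 1 * t 0 + ∑< n (λ i → + multichoose s (suc i) * t (suc i))) + shifted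
    ≡⟨ cong (_+ shifted) (sym (∑<-first n (λ i → + multichoose s i * t i))) ⟩
  ∑< (suc n) (λ i → + multichoose s i * t i) + shifted
    ≡⟨ cong (_+ shifted) (extend s) ⟨
  ∑< n (λ i → + multichoose s i * t i) + shifted ∎
  where
  shifted = ∑< n (λ i → + multichoose (suc s) i * t (suc i))

  extend : ∀ s → ∑< n (λ i → + multichoose s i * t i) ≡ ∑< (suc n) (λ i → + multichoose s i * t i)
  extend s = sym (begin
    ∑< (suc n) (λ i → + multichoose s i * t i)
      ≡⟨ ∑<-last n _ ⟩
    ∑< n (λ i → + multichoose s i * t i) + + multichoose s n * t n
      ≡⟨ cong (_+_ (∑< n (λ i → + multichoose s i * t i)))
           (trans (cong (_*_ (+ multichoose s n)) tn≡0) (ℤₚ.*-zeroʳ (+ multichoose s n))) ⟩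
    ∑< n (λ i → + multichoose s i * t i) + + 0
      ≡⟨ ℤₚ.+-identityʳ _ ⟩
    ∑< n (λ i → + multichoose s i * t i) ∎)

-- The value at a of (1 − Y)⁻ˢ applied to the unit, with Y as in the header: multichoose s i
-- is the coefficient of yⁱ in (1 − y)⁻ˢ, and cutting off at i < B loses nothing when the
-- entries of a are at most B, because c i x = 0 for i ≥ x.
T : ℕ → ℕ → ∀ {m} → Vec ℕ m → ℤ
T B s []      = + 1
T B s (x ∷ a) = ∑< B λ i → + multichoose s i * (c i x * T B (s ℕ.+ i) a)

InRange : ℕ → ℕ → Set
InRange B x = 1 ≤ x × x ≤ B

-- This is `(1 − Y)⁻⁽ˢ⁺¹⁾ = (1 − Y)⁻ˢ + Y (1 − Y)⁻⁽ˢ⁺¹⁾`. The induction hypothesis, used at exponent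
-- `s + i`, splits off the part of `Y` acting on the tail; `∑<-multichoose` splits off the first
-- coordinate, where `y ⋆ c i = c (suc i)` realises the shift.
T-recurrence : ∀ B s {m} (a : Vec ℕ m) → All (InRange B) a →
  T B (suc s) a ≡ T B s a + sum (λ j → (𝟙−e⋆μ ⋆ (λ n → T B (suc s) (a [ j ]≔ n))) (lookup a j))
T-recurrence B s [] [] = refl
T-recurrence B s {suc m} (suc x ∷ a) ((s≤s z≤n , x<B) ∷ a-range) = begin
  ∑< B (λ i → w i * (C i * T B (suc (s ℕ.+ i)) a))
    ≡⟨ ∑<-cong B (λ i _ → trans (cong (λ z → w i * (C i * z)) (T-recurrence B (s ℕ.+ i) a a-range))
                               (distrib (w i) (C i) (T B (s ℕ.+ i) a) (sum (Y i)))) ⟩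
  ∑< B (λ i → w i * G i + w i * (C i * sum (Y i)))
    ≡⟨ ∑<-distrib-+ B _ _ ⟩
  ∑< B (λ i → w i * G i) + ∑< B (λ i → w i * (C i * sum (Y i)))
    ≡⟨ cong₂ _+_ (∑<-multichoose s B G (cong (_* T B (s ℕ.+ B) a) (c-vanish B (s≤s z≤n) x<B))) (sym tails) ⟩
  (T B s (suc x ∷ a) + ∑< B (λ i → w i * G (suc i))) + sum tailTerm
    ≡⟨ cong (λ z → (T B s (suc x ∷ a) + z) + sum tailTerm) headTerm ⟨
  (T B s (suc x ∷ a) + (𝟙−e⋆μ ⋆ (λ n → T B (suc s) (n ∷ a))) (suc x)) + sum tailTerm
    ≡⟨ ℤₚ.+-assoc (T B s (suc x ∷ a)) _ (sum tailTerm) ⟩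
  _ ∎
  where
  w C G : ℕ → ℤ
  w i = + multichoose (suc s) i
  C i = c i (suc x)
  G i = C i * T B (s ℕ.+ i) a

  Y : ℕ → Fin m → ℤ
  Y i j = (𝟙−e⋆μ ⋆ (λ n → T B (suc (s ℕ.+ i)) (a [ j ]≔ n))) (lookup a j)

  tailTerm : Fin m → ℤ
  tailTerm j = (𝟙−e⋆μ ⋆ (λ n → T B (suc s) (suc x ∷ a [ j ]≔ n))) (lookup a j)

  distrib : ∀ w c t y → w * (c * (t + y)) ≡ w * (c * t) + w * (c * y)
  distrib = solve-∀

  rearrange : ∀ w c t → w * (c * t) ≡ w * t * c
  rearrange = solve-∀

  headTerm : (𝟙−e⋆μ ⋆ (λ n → T B (suc s) (n ∷ a))) (suc x) ≡ ∑< B (λ i → w i * G (suc i))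
  headTerm = begin
    (𝟙−e⋆μ ⋆ (λ n → ∑< B (λ i → w i * (c i n * t i)))) (suc x)
      ≡⟨ ⋆-∑<ʳ B 𝟙−e⋆μ (λ i n → w i * (c i n * t i)) (suc x) ⟩
    ∑< B (λ i → (𝟙−e⋆μ ⋆ (λ n → w i * (c i n * t i))) (suc x))
      ≡⟨ ∑<-cong B (λ i _ → begin
           (𝟙−e⋆μ ⋆ (λ n → w i * (c i n * t i))) (suc x)
             ≡⟨ ⋆-cong {𝟙−e⋆μ} (λ _ → refl) (λ n → rearrange (w i) (c i (suc n)) (t i)) x ⟩
           (𝟙−e⋆μ ⋆ (λ n → w i * t i * c i n)) (suc x)
             ≡⟨ ⋆-*ʳ (w i * t i) 𝟙−e⋆μ (c i) (suc x) ⟩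
           w i * t i * (𝟙−e⋆μ ⋆ c i) (suc x)
             ≡⟨ cong (_*_ (w i * t i)) (c-suc i x) ⟨
           w i * t i * C (suc i)
             ≡⟨ rearrange (w i) (C (suc i)) (t i) ⟨
           w i * (C (suc i) * t i)
             ≡⟨ cong (λ k → w i * (C (suc i) * T B k a)) (ℕₚ.+-suc s i) ⟨
           w i * G (suc i) ∎) ⟩
    ∑< B (λ i → w i * G (suc i)) ∎
    where
    t : ℕ → ℤ
    t i = T B (suc (s ℕ.+ i)) a

  tails : sum tailTerm ≡ ∑< B (λ i → w i * (C i * sum (Y i)))
  tails = begin
    sum tailTerm
      ≡⟨ sum-cong-≗ (λ j → trans
           (⋆-∑<ʳ B 𝟙−e⋆μ (λ i n → w i * (C i * T B (suc (s ℕ.+ i)) (a [ j ]≔ n))) (lookup a j))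
           (∑<-cong B λ i _ → trans
             (⋆-*ʳ (w i) 𝟙−e⋆μ (λ n → C i * T B (suc (s ℕ.+ i)) (a [ j ]≔ n)) (lookup a j))
             (cong (_*_ (w i)) (⋆-*ʳ (C i) 𝟙−e⋆μ (λ n → T B (suc (s ℕ.+ i)) (a [ j ]≔ n)) (lookup a j))))) ⟩
    sum {m} (λ j → ∑< B (λ i → w i * (C i * Y i j)))
      ≡⟨ ∑<-sum-comm {m} B (λ j i → w i * (C i * Y i j)) ⟩
    ∑< B (λ i → sum {m} (λ j → w i * (C i * Y i j)))
      ≡⟨ ∑<-cong B (λ i _ → trans (cong (_*_ (w i)) (*-distribˡ-sum (C i) (Y i))) (*-distribˡ-sum (w i) (λ j → C i * Y i j))) ⟨
    ∑< B (λ i → w i * (C i * sum (Y i))) ∎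

-- `(1 − Y)⁰` is the unit: `multichoose 0` vanishes except at index `0`, which is in range because
-- the bound is a successor.
T-zero-∷ : ∀ B x {m} (a : Vec ℕ m) → T (suc B) 0 (suc x ∷ a) ≡ e (suc x) * T (suc B) 0 a
T-zero-∷ B x a = begin
  T (suc B) 0 (suc x ∷ a)
    ≡⟨ ∑<-only (suc B) _ (s≤s z≤n) (λ { zero 0≢0 → contradiction refl 0≢0 ; (suc i) _ → refl }) ⟩
  + 1 * (c 0 (suc x) * T (suc B) 0 a)
    ≡⟨ ℤₚ.*-identityˡ _ ⟩
  c 0 (suc x) * T (suc B) 0 a
    ≡⟨ cong (_* T (suc B) 0 a) (c-zero x) ⟩
  e (suc x) * T (suc B) 0 a ∎

T-zero-ones : ∀ B {m} {a : Vec ℕ m} → All (_≡ 1) a → T (suc B) 0 a ≡ + 1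
T-zero-ones B []           = refl
T-zero-ones B (_∷_ {xs = a} refl a≡1) = trans (T-zero-∷ B 0 a) (trans (ℤₚ.*-identityˡ _) (T-zero-ones B a≡1))

T-zero-¬ones : ∀ B {m} {a : Vec ℕ m} → All (1 ≤_) a → ¬ All (_≡ 1) a → T (suc B) 0 a ≡ + 0
T-zero-¬ones B [] a≢1 = contradiction [] a≢1
T-zero-¬ones B {a = suc zero ∷ a} (_ ∷ 1≤a) a≢1 =
  trans (T-zero-∷ B 0 a) (cong (_*_ (+ 1)) (T-zero-¬ones B 1≤a (a≢1 ∘ (refl ∷_))))
T-zero-¬ones B {a = suc (suc x) ∷ a} _ _ = T-zero-∷ B (suc x) a

-- Multinomial coefficients

-- Identifies `multichoose (suc s) i` with a binomial coefficient, cleared of denominators. The two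
-- Pascal terms contribute `suc s` and `suc i` copies of the smaller factorial, which add up to the
-- next factor.
multichoose-! : ∀ s i → multichoose (suc s) i ℕ.* (i ! ℕ.* s !) ≡ (i ℕ.+ s) !
multichoose-! s zero = trans (ℕₚ.*-identityˡ _) (ℕₚ.*-identityˡ _)
multichoose-! zero (suc i) = begin
  multichoose 1 i ℕ.* (suc i ℕ.* i ! ℕ.* 1)   ≡⟨ rearrange (multichoose 1 i) (suc i) (i !) 1 ⟩
  suc i ℕ.* (multichoose 1 i ℕ.* (i ! ℕ.* 1)) ≡⟨ cong₂ ℕ._*_ (cong suc (sym (ℕₚ.+-identityʳ i))) (multichoose-! 0 i) ⟩
  suc (i ℕ.+ 0) ℕ.* (i ℕ.+ 0) !               ∎
  where
  rearrange : ∀ a b c d → a ℕ.* (b ℕ.* c ℕ.* d) ≡ b ℕ.* (a ℕ.* (c ℕ.* d))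
  rearrange = ℕ-Solver.solve-∀
multichoose-! (suc s) (suc i) = begin
  (A ℕ.+ A′) ℕ.* (suc i ℕ.* i ! ℕ.* (suc s ℕ.* s !))
    ≡⟨ rearrange A A′ (suc i) (i !) (suc s) (s !) ⟩
  suc s ℕ.* (A ℕ.* (suc i ℕ.* i ! ℕ.* s !)) ℕ.+ suc i ℕ.* (A′ ℕ.* (i ! ℕ.* (suc s ℕ.* s !)))
    ≡⟨ cong₂ (λ x y → suc s ℕ.* x ℕ.+ suc i ℕ.* y) (multichoose-! s (suc i)) (multichoose-! (suc s) i) ⟩
  suc s ℕ.* (suc (i ℕ.+ s)) ! ℕ.+ suc i ℕ.* (i ℕ.+ suc s) !
    ≡⟨ cong (λ n → suc s ℕ.* n ! ℕ.+ suc i ℕ.* (i ℕ.+ suc s) !) (ℕₚ.+-suc i s) ⟨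
  suc s ℕ.* (i ℕ.+ suc s) ! ℕ.+ suc i ℕ.* (i ℕ.+ suc s) !
    ≡⟨ ℕₚ.*-distribʳ-+ ((i ℕ.+ suc s) !) (suc s) (suc i) ⟨
  (suc s ℕ.+ suc i) ℕ.* (i ℕ.+ suc s) !
    ≡⟨ cong (ℕ._* (i ℕ.+ suc s) !) (ℕₚ.+-comm (suc s) (suc i)) ⟩
  (suc i ℕ.+ suc s) ℕ.* (i ℕ.+ suc s) ! ∎
  where
  A  = multichoose (suc s) (suc i)
  A′ = multichoose (suc (suc s)) i

  rearrange : ∀ a a′ p x q y → (a ℕ.+ a′) ℕ.* (p ℕ.* x ℕ.* (q ℕ.* y)) ≡
              q ℕ.* (a ℕ.* (p ℕ.* x ℕ.* y)) ℕ.+ p ℕ.* (a′ ℕ.* (x ℕ.* (q ℕ.* y)))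
  rearrange = ℕ-Solver.solve-∀

-- Both sides are the trinomial coefficient of `(h, k, r)`, chosen in two orders. It moves the
-- weight of the first coordinate out of the multinomial.
multichoose-absorb : ∀ r h k → multichoose (suc r) (h ℕ.+ k) ℕ.* multichoose (suc h) k ≡
                     multichoose (suc r) h ℕ.* multichoose (suc (r ℕ.+ h)) k
multichoose-absorb r h k = ℕₚ.*-cancelʳ-≡ _ _ (k ! ℕ.* h ! ℕ.* r !) {{nonZero}} (begin
  A ℕ.* multichoose (suc h) k ℕ.* (k ! ℕ.* h ! ℕ.* r !)
    ≡⟨ rearrange₁ A (multichoose (suc h) k) (k !) (h !) (r !) ⟩
  A ℕ.* (multichoose (suc h) k ℕ.* (k ! ℕ.* h !) ℕ.* r !)
    ≡⟨ cong (λ x → A ℕ.* (x ℕ.* r !)) (trans (multichoose-! h k) (cong _! (ℕₚ.+-comm k h))) ⟩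
  A ℕ.* ((h ℕ.+ k) ! ℕ.* r !)
    ≡⟨ multichoose-! r (h ℕ.+ k) ⟩
  (h ℕ.+ k ℕ.+ r) !
    ≡⟨ cong _! (sum-comm h k r) ⟩
  (k ℕ.+ (r ℕ.+ h)) !
    ≡⟨ multichoose-! (r ℕ.+ h) k ⟨
  B ℕ.* (k ! ℕ.* (r ℕ.+ h) !)
    ≡⟨ cong (λ x → B ℕ.* (k ! ℕ.* x)) (trans (multichoose-! r h) (cong _! (ℕₚ.+-comm h r))) ⟨
  B ℕ.* (k ! ℕ.* (C ℕ.* (h ! ℕ.* r !)))
    ≡⟨ rearrange₂ B (k !) C (h !) (r !) ⟩
  C ℕ.* B ℕ.* (k ! ℕ.* h ! ℕ.* r !) ∎)
  where
  A = multichoose (suc r) (h ℕ.+ k)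
  B = multichoose (suc (r ℕ.+ h)) k
  C = multichoose (suc r) h

  nonZero : NonZero (k ! ℕ.* h ! ℕ.* r !)
  nonZero = ℕₚ.m*n≢0 (k ! ℕ.* h !) (r !) {{ℕₚ.m*n≢0 (k !) (h !) {{k ℕₚ.!≢0}} {{h ℕₚ.!≢0}}}} {{r ℕₚ.!≢0}}

  rearrange₁ : ∀ a b k h r → a ℕ.* b ℕ.* (k ℕ.* h ℕ.* r) ≡ a ℕ.* (b ℕ.* (k ℕ.* h) ℕ.* r)
  rearrange₁ = ℕ-Solver.solve-∀

  rearrange₂ : ∀ b k c h r → b ℕ.* (k ℕ.* (c ℕ.* (h ℕ.* r))) ≡ c ℕ.* b ℕ.* (k ℕ.* h ℕ.* r)
  rearrange₂ = ℕ-Solver.solve-∀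

  sum-comm : ∀ h k r → h ℕ.+ k ℕ.+ r ≡ k ℕ.+ (r ℕ.+ h)
  sum-comm = ℕ-Solver.solve-∀

-- The factor multichoose (suc h) k is the binomial coefficient (h + k choose h).
multinomial′ : ∀ {m} → Vector ℕ m → ℕ
multinomial′ {zero}  l = 1
multinomial′ {suc m} l = multichoose (suc (head l)) ∣ tail l ∣ᵥ ℕ.* multinomial′ (tail l)

multinomial′-factProd : ∀ {m} (l : Vector ℕ m) → multinomial′ l ℕ.* factProd l ≡ ∣ l ∣ᵥ !
multinomial′-factProd {zero}  l = refl
multinomial′-factProd {suc m} l = begin
  A ℕ.* multinomial′ (tail l) ℕ.* (head l ! ℕ.* factProd (tail l))
    ≡⟨ rearrange A (multinomial′ (tail l)) (head l !) (factProd (tail l)) ⟩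
  A ℕ.* (multinomial′ (tail l) ℕ.* factProd (tail l) ℕ.* head l !)
    ≡⟨ cong (λ x → A ℕ.* (x ℕ.* head l !)) (multinomial′-factProd (tail l)) ⟩
  A ℕ.* (∣ tail l ∣ᵥ ! ℕ.* head l !)
    ≡⟨ multichoose-! (head l) ∣ tail l ∣ᵥ ⟩
  (∣ tail l ∣ᵥ ℕ.+ head l) !
    ≡⟨ cong _! (ℕₚ.+-comm ∣ tail l ∣ᵥ (head l)) ⟩
  ∣ l ∣ᵥ ! ∎
  where
  A = multichoose (suc (head l)) ∣ tail l ∣ᵥ

  rearrange : ∀ a b c d → a ℕ.* b ℕ.* (c ℕ.* d) ≡ a ℕ.* (b ℕ.* d ℕ.* c)
  rearrange = ℕ-Solver.solve-∀

multinomial≡multinomial′ : ∀ {m} (l : Vector ℕ m) → multinomial l ≡ multinomial′ l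
multinomial≡multinomial′ l = begin
  ∣ l ∣ᵥ ! / factProd l                       ≡⟨ cong (_/ factProd l) (multinomial′-factProd l) ⟨
  (multinomial′ l ℕ.* factProd l) / factProd l ≡⟨ m*n/n≡m (multinomial′ l) (factProd l) ⟩
  multinomial′ l                               ∎
  where instance _ = factProd≢0 l

-- The multinomial sum as a negative power of 1 - Y

boxSum-cong : ∀ {m} (b : Vector ℕ m) {F G : Vector ℕ m → ℤ} → (∀ l → F l ≡ G l) → boxSum b F ≡ boxSum b G
boxSum-cong {zero}  b F≡G = F≡G _
boxSum-cong {suc m} b F≡G =
  cong Σℤ (map-cong (λ k → boxSum-cong (tail b) λ l → F≡G (suc k ∷ᵥ l)) (upTo (head b)))

boxSum-* : ∀ {m} (b : Vector ℕ m) x (F : Vector ℕ m → ℤ) → boxSum b (λ l → x * F l) ≡ x * boxSum b F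
boxSum-* {zero}  b x F = refl
boxSum-* {suc m} b x F = begin
  Σℤ (map (λ k → boxSum (tail b) λ l → x * F (suc k ∷ᵥ l)) (upTo (head b)))
    ≡⟨ cong Σℤ (map-cong (λ k → boxSum-* (tail b) x λ l → F (suc k ∷ᵥ l)) (upTo (head b))) ⟩
  Σℤ (map (λ k → x * t k) (upTo (head b)))
    ≡⟨ Σℤ-upTo (λ k → x * t k) (head b) ⟩
  ∑< (head b) (λ k → x * t k)
    ≡⟨ ∑<-distribˡ-* (head b) x t ⟨
  x * ∑< (head b) t
    ≡⟨ cong (_*_ x) (Σℤ-upTo t (head b)) ⟨
  x * boxSum b F ∎
  where
  t : ℕ → ℤ
  t k = boxSum (tail b) (λ l → F (suc k ∷ᵥ l))

-- `(1 − Y)⁻⁽ʳ⁺¹⁾` is the sum of `multichoose (suc r) k · Yᵏ`, and `Yᵏ` expands multinomially. The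
-- general `r` is needed since the tail is met at `r + l₁`; at `r = 0` the extra weight is `1`.
boxSum-multichoose : ∀ B r {m} (a : Vector ℕ m) → (∀ j → 2 ≤ a j × a j < B) →
  boxSum a (λ l → + (multichoose (suc r) ∣ l ∣ᵥ ℕ.* multinomial′ l) * Πℤ (λ j → c (l j) (a j))) ≡
  T B (suc r) (tabulate a)
boxSum-multichoose B r {zero}  a a-range = refl
boxSum-multichoose B r {suc m} a a-range = begin
  Σℤ (map (λ k → boxSum (tail a) (F k)) (upTo (head a)))
    ≡⟨ Σℤ-upTo (λ k → boxSum (tail a) (F k)) (head a) ⟩
  ∑< (head a) (λ k → boxSum (tail a) (F k))
    ≡⟨ ∑<-cong (head a) (λ k _ → inner k) ⟩
  ∑< (head a) (t ∘ suc)
    -- The box runs over `1, ..., a₁`, while `T` runs over `0, ..., B − 1`. Index `0` is free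
    -- because `e` vanishes at `a₁ ≥ 2`, indices above `a₁` because of `c-vanish`.
    ≡⟨ ℤₚ.+-identityˡ _ ⟨
  + 0 + ∑< (head a) (t ∘ suc)
    ≡⟨ cong (_+ ∑< (head a) (t ∘ suc)) t-zero ⟨
  t 0 + ∑< (head a) (t ∘ suc)
    ≡⟨ ∑<-first (head a) t ⟨
  ∑< (suc (head a)) t
    ≡⟨ ∑<-extend t (proj₂ (a-range zero)) t-large ⟩
  ∑< B t ∎
  where
  F : ℕ → Vector ℕ m → ℤ
  F k l = + (multichoose (suc r) (suc k ℕ.+ ∣ l ∣ᵥ) ℕ.* (multichoose (suc (suc k)) ∣ l ∣ᵥ ℕ.* multinomial′ l)) *
          (c (suc k) (head a) * Πℤ (λ j → c (l j) (tail a j)))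

  t : ℕ → ℤ
  t i = + multichoose (suc r) i * (c i (head a) * T B (suc (r ℕ.+ i)) (tabulate (tail a)))

  c-head-zero : ∀ {x} → 2 ≤ x → c 0 x ≡ + 0
  c-head-zero {suc (suc x)} (s≤s (s≤s z≤n)) = c-zero (suc x)

  t-zero : t 0 ≡ + 0
  t-zero = trans (cong (λ x → + multichoose (suc r) 0 * (x * T B (suc (r ℕ.+ 0)) (tabulate (tail a)))) (c-head-zero (proj₁ (a-range zero))))
                 (ℤₚ.*-zeroʳ (+ multichoose (suc r) 0))

  t-large : ∀ i → suc (head a) ≤ i → t i ≡ + 0
  t-large i a<i = trans
    (cong (λ x → + multichoose (suc r) i * (x * T B (suc (r ℕ.+ i)) (tabulate (tail a))))
      (c-vanish i (ℕₚ.<⇒≤ (proj₁ (a-range zero))) (ℕₚ.<⇒≤ a<i)))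
    (ℤₚ.*-zeroʳ (+ multichoose (suc r) i))

  inner : ∀ k → boxSum (tail a) (F k) ≡ t (suc k)
  inner k = begin
    boxSum (tail a) (F k)
      ≡⟨ boxSum-cong (tail a) factor ⟩
    boxSum (tail a) (λ l → w * C * (+ (multichoose (suc (r ℕ.+ suc k)) ∣ l ∣ᵥ ℕ.* multinomial′ l) * Πℤ (λ j → c (l j) (tail a j))))
      ≡⟨ boxSum-* (tail a) (w * C) _ ⟩
    w * C * boxSum (tail a) (λ l → + (multichoose (suc (r ℕ.+ suc k)) ∣ l ∣ᵥ ℕ.* multinomial′ l) * Πℤ (λ j → c (l j) (tail a j)))
      ≡⟨ cong (_*_ (w * C)) (boxSum-multichoose B (r ℕ.+ suc k) (tail a) (a-range ∘ suc)) ⟩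
    w * C * T B (suc (r ℕ.+ suc k)) (tabulate (tail a))
      ≡⟨ ℤₚ.*-assoc w C _ ⟩
    t (suc k) ∎
    where
    w = + multichoose (suc r) (suc k)
    C = c (suc k) (head a)

    rearrange : ∀ w d p c → w * d * (c * p) ≡ w * c * (d * p)
    rearrange = solve-∀

    factor : ∀ l → F k l ≡ w * C * (+ (multichoose (suc (r ℕ.+ suc k)) ∣ l ∣ᵥ ℕ.* multinomial′ l) * Πℤ (λ j → c (l j) (tail a j)))
    factor l = begin
      + (X ℕ.* (multichoose (suc (suc k)) ∣ l ∣ᵥ ℕ.* M)) * (C * P)
        ≡⟨ cong (λ z → + z * (C * P)) (trans (sym (ℕₚ.*-assoc X _ M)) (trans (cong (ℕ._* M) (multichoose-absorb r (suc k) ∣ l ∣ᵥ)) (ℕₚ.*-assoc W _ M))) ⟩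
      + (W ℕ.* (Z ℕ.* M)) * (C * P)
        ≡⟨ cong (_* (C * P)) (ℤₚ.pos-* W (Z ℕ.* M)) ⟩
      w * + (Z ℕ.* M) * (C * P)
        ≡⟨ rearrange w (+ (Z ℕ.* M)) P C ⟩
      w * C * (+ (Z ℕ.* M) * P) ∎
      where
      X = multichoose (suc r) (suc k ℕ.+ ∣ l ∣ᵥ)
      W = multichoose (suc r) (suc k)
      Z = multichoose (suc (r ℕ.+ suc k)) ∣ l ∣ᵥ
      M = multinomial′ l
      P = Πℤ (λ j → c (l j) (tail a j))

multichoose-one : ∀ i → multichoose 1 i ≡ 1
multichoose-one zero    = refl
multichoose-one (suc i) = multichoose-one i

boxSum-summand : ∀ B {m} (a : Vector ℕ m) → (∀ j → 2 ≤ a j × a j < B) →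
  boxSum a (summand a) ≡ T B 1 (tabulate a)
boxSum-summand B a a-range = trans
  (boxSum-cong a λ l → cong (λ x → + x * Πℤ (λ j → c (l j) (a j)))
    (trans (multinomial≡multinomial′ l)
      (sym (trans (cong (ℕ._* multinomial′ l) (multichoose-one ∣ l ∣ᵥ)) (ℕₚ.*-identityˡ _)))))
  (boxSum-multichoose B 0 a a-range)

Πℤ-zero : ∀ {m} (v : Vector ℤ m) j → v j ≡ + 0 → Πℤ v ≡ + 0
Πℤ-zero {suc m} v zero    v≡0 = cong (_* Πℤ (tail v)) v≡0
Πℤ-zero {suc m} v (suc j) v≡0 = trans (cong (_*_ (head v)) (Πℤ-zero (tail v) j v≡0)) (ℤₚ.*-zeroʳ (head v))

summand-vanish : ∀ {m} (a l : Vector ℕ m) j → 1 ≤ a j → a j ≤ l j → summand a l ≡ + 0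
summand-vanish a l j 1≤a a≤l = trans
  (cong (_*_ (+ multinomial l)) (Πℤ-zero (λ j → c (l j) (a j)) j (c-vanish (l j) 1≤a a≤l)))
  (ℤₚ.*-zeroʳ (+ multinomial l))

-- Enumerating joint ordered factorisations

-- The size is an integer, so that it can be transported along identities with subtraction.
record Enumeration {A : Set} (P : A → Set) (size : ℤ) : Set where
  field
    list        : List A
    unique      : Unique list
    ∈⇔P         : ∀ x → x ∈ list ⇔ P x
    length≡size : + length list ≡ size

open Enumeration

module _ {A : Set} where

  enum-⇔ : ∀ {P Q : A → Set} {z} → (∀ x → P x ⇔ Q x) → Enumeration P z → Enumeration Q z
  enum-⇔ P⇔Q E = record
    { list        = list E
    ; unique      = unique E
    ; ∈⇔P         = λ x → mk⇔ (Equivalence.to (P⇔Q x) ∘ Equivalence.to (∈⇔P E x))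
                              (Equivalence.from (∈⇔P E x) ∘ Equivalence.from (P⇔Q x))
    ; length≡size = length≡size E
    }

  enum-∅ : ∀ {P : A → Set} → (∀ x → ¬ P x) → Enumeration P (+ 0)
  enum-∅ ¬P = record
    { list        = []
    ; unique      = []
    ; ∈⇔P         = λ x → mk⇔ (λ ()) (λ p → contradiction p (¬P x))
    ; length≡size = refl
    }

  enum-singleton : ∀ {P : A → Set} {a} → P a → (∀ x → P x → x ≡ a) → Enumeration P (+ 1)
  enum-singleton {a = a} p P⇒≡ = record
    { list        = a ∷ []
    ; unique      = [] ∷ []
    ; ∈⇔P         = λ x → mk⇔ (λ { (here refl) → p }) (λ q → here (P⇒≡ x q))
    ; length≡size = refl
    }

  enum-⊎ : ∀ {P Q : A → Set} {y z} → (∀ {x} → P x → Q x → ⊥) →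
           Enumeration P y → Enumeration Q z → Enumeration (λ x → P x ⊎ Q x) (y + z)
  enum-⊎ {P} {Q} disjoint E F = record
    { list        = list E ++ list F
    ; unique      = Unique.++⁺ (unique E) (unique F)
                      λ { (x∈E , x∈F) → disjoint (Equivalence.to (∈⇔P E _) x∈E) (Equivalence.to (∈⇔P F _) x∈F) }
    ; ∈⇔P         = λ x → mk⇔ (to x) (from x)
    ; length≡size = trans (cong +_ (length-++ (list E)))
                      (trans (ℤₚ.pos-+ (length (list E)) _) (cong₂ _+_ (length≡size E) (length≡size F)))
    }
    where
    to : ∀ x → x ∈ list E ++ list F → P x ⊎ Q x
    to x x∈ with ∈-++⁻ (list E) x∈
    ... | inj₁ x∈E = inj₁ (Equivalence.to (∈⇔P E x) x∈E)
    ... | inj₂ x∈F = inj₂ (Equivalence.to (∈⇔P F x) x∈F)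

    from : ∀ x → P x ⊎ Q x → x ∈ list E ++ list F
    from x (inj₁ p) = ∈-++⁺ˡ (Equivalence.from (∈⇔P E x) p)
    from x (inj₂ q) = ∈-++⁺ʳ (list E) (Equivalence.from (∈⇔P F x) q)

  enum-∃ : ∀ {n} {P : Fin n → A → Set} {z : Fin n → ℤ} → (∀ {i j x} → P i x → P j x → i ≡ j) →
           (∀ i → Enumeration (P i) (z i)) → Enumeration (λ x → ∃ λ i → P i x) (sum z)
  enum-∃ {zero}          disjoint E = enum-∅ λ { _ (() , _) }
  enum-∃ {suc n} {P = P} disjoint E = enum-⇔
    (λ x → mk⇔ (λ { (inj₁ p) → zero , p ; (inj₂ (i , p)) → suc i , p })
               (λ { (zero , p) → inj₁ p ; (suc i , p) → inj₂ (i , p) }))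
    (enum-⊎ (λ { p (i , q) → contradiction (disjoint p q) λ () }) (E zero)
      (enum-∃ (λ p q → suc-injective (disjoint p q)) (E ∘ suc)))

enum-map : ∀ {A B : Set} {P : A → Set} {z} (f : A → B) → (∀ {x y} → f x ≡ f y → x ≡ y) →
           Enumeration P z → Enumeration (λ y → ∃ λ x → y ≡ f x × P x) z
enum-map f f-injective E = record
  { list        = List.map f (list E)
  ; unique      = Unique.map⁺ f-injective (unique E)
  ; ∈⇔P         = λ y → mk⇔
      (λ y∈ → let x , x∈E , y≡fx = ∈-map⁻ f y∈ in x , y≡fx , Equivalence.to (∈⇔P E x) x∈E)
      (λ { (x , refl , p) → ∈-map⁺ f (Equivalence.from (∈⇔P E x) p) })
  ; length≡size = trans (cong +_ (length-map f (list E))) (length≡size E)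
  }

-- Removing the first factor

All-[]≔ : ∀ {P : ℕ → Set} {m} {a : Vec ℕ m} i {x} → All P a → P x → All P (a [ i ]≔ x)
All-[]≔ zero    (_ ∷ ps) q = q ∷ ps
All-[]≔ (suc i) (p ∷ ps) q = p ∷ All-[]≔ i ps q

sum-[]≔-< : ∀ {m} (a : Vec ℕ m) i {x} → x < lookup a i → Vec.sum (a [ i ]≔ x) < Vec.sum a
sum-[]≔-< (y ∷ a) zero    x<y = ℕₚ.+-monoˡ-< (Vec.sum a) x<y
sum-[]≔-< (y ∷ a) (suc i) x<y = ℕₚ.+-monoʳ-< y (sum-[]≔-< a i x<y)

JOF : ∀ {m} → Vec ℕ m → List (Fin m × ℕ) → Set
JOF a = IsJointOrdFact (lookup a)

StartsWith : ∀ {m} → Fin m → List (Fin m × ℕ) → Set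
StartsWith i t = ∃₂ λ d s → t ≡ (i , d) ∷ s

prodAt-≡ : ∀ {m} (i : Fin m) d s → prodAt i ((i , d) ∷ s) ≡ d ℕ.* prodAt i s
prodAt-≡ i d s with i Fin.≟ i
... | yes _  = refl
... | no i≢i = contradiction refl i≢i

prodAt-≢ : ∀ {m} {i j : Fin m} d s → i ≢ j → prodAt j ((i , d) ∷ s) ≡ prodAt j s
prodAt-≢ {i = i} {j} d s i≢j with i Fin.≟ j
... | yes i≡j = contradiction i≡j i≢j
... | no _    = refl

linked-tail : ∀ {m} {p : Fin m × ℕ} {s} → Linked (λ p q → proj₁ p ≢ proj₁ q) (p ∷ s) →
              Linked (λ p q → proj₁ p ≢ proj₁ q) s
linked-tail [-]      = []
linked-tail (_ ∷ ps) = ps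

linked-head : ∀ {m} {i : Fin m} {d s} → Linked (λ p q → proj₁ p ≢ proj₁ q) ((i , d) ∷ s) → ¬ StartsWith i s
linked-head (i≢i ∷ _) (_ , _ , refl) = i≢i refl

linked-∷ : ∀ {m} {i : Fin m} {d s} → ¬ StartsWith i s → Linked (λ p q → proj₁ p ≢ proj₁ q) s →
           Linked (λ p q → proj₁ p ≢ proj₁ q) ((i , d) ∷ s)
linked-∷ {s = []}          ¬start _  = [-]
linked-∷ {s = (j , d) ∷ s} ¬start ps = (λ { refl → ¬start (d , s , refl) }) ∷ ps

-- The adjacency condition at the head concerns only the next entry, so it amounts to the rest not
-- starting in coordinate `i`. Cancelling the nonzero first factor leaves `q` in that coordinate.
JOF-∷ : ∀ {m} {a : Vec ℕ m} {i d q s} → suc d ℕ.* q ≡ lookup a i → 2 ≤ suc d →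
        (¬ StartsWith i s × JOF (a [ i ]≔ q) s) ⇔ JOF a ((i , suc d) ∷ s)
JOF-∷ {a = a} {i} {d} {q} {s} dq≡aᵢ 2≤d = mk⇔ to from
  where
  to : ¬ StartsWith i s × JOF (a [ i ]≔ q) s → JOF a ((i , suc d) ∷ s)
  to (¬start , 2≤s , linked , prods) = 2≤d ∷ 2≤s , linked-∷ ¬start linked , prods′
    where
    prods′ : ∀ j → prodAt j ((i , suc d) ∷ s) ≡ lookup a j
    prods′ j with i Fin.≟ j
    ... | yes refl = trans (cong (suc d ℕ.*_) (trans (prods i) (lookup∘update i a q))) dq≡aᵢ
    ... | no i≢j   = trans (prods j) (lookup∘update′ (i≢j ∘ sym) a q)

  from : JOF a ((i , suc d) ∷ s) → ¬ StartsWith i s × JOF (a [ i ]≔ q) s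
  from (_ ∷ 2≤s , linked , prods) = linked-head linked , 2≤s , linked-tail linked , prods′
    where
    prods′ : ∀ j → prodAt j s ≡ lookup (a [ i ]≔ q) j
    prods′ j with i Fin.≟ j
    ... | yes refl = trans
      (ℕₚ.*-cancelˡ-≡ _ _ (suc d) (trans (sym (prodAt-≡ i (suc d) s)) (trans (prods i) (sym dq≡aᵢ))))
      (sym (lookup∘update i a q))
    ... | no i≢j = trans (sym (prodAt-≢ (suc d) s i≢j)) (trans (prods j) (sym (lookup∘update′ (i≢j ∘ sym) a q)))

JOF-∣ : ∀ {m} {a : Vec ℕ m} {i d s} → JOF a ((i , d) ∷ s) → d ∣ lookup a i
JOF-∣ {i = i} {d} {s} (_ , _ , prods) = subst (d ∣_) (trans (sym (prodAt-≡ i d s)) (prods i)) (m∣m*n (prodAt i s))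

-- Counting by the coordinate of the first factor

module _ (b : ℕ) where

  private B = suc b

  -- The `Nⱼ` of the overview, so far only a signed expression; `enum-start` shows that it counts
  -- something.
  startCount : ∀ {m} → Vec ℕ m → Fin m → ℤ
  startCount a i = (𝟙−e⋆μ ⋆ (λ n → T B 1 (a [ i ]≔ n))) (lookup a i)

  avoidCount : ∀ {m} → Vec ℕ m → Fin m → ℤ
  avoidCount a i = T B 1 a + - + 1 * startCount a i

  StartEnum : ∀ {m} → Vec ℕ m → Set
  StartEnum a = ∀ i → Enumeration (λ t → StartsWith i t × JOF a t) (startCount a i)

  startCount-recurrence : ∀ {m} (a : Vec ℕ m) i {x} → lookup a i ≡ suc x →
    startCount a i ≡ (𝟙−e ⋆ (λ n → avoidCount (a [ i ]≔ n) i)) (suc x)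
  startCount-recurrence a i {x} aᵢ≡x = begin
    (𝟙−e⋆μ ⋆ g) (lookup a i)
      ≡⟨ cong (𝟙−e⋆μ ⋆ g) aᵢ≡x ⟩
    (𝟙−e⋆μ ⋆ g) (suc x)
      ≡⟨ 𝟙−e⋆μ-fixpoint g x ⟩
    (𝟙−e ⋆ (λ n → g n + - + 1 * (𝟙−e⋆μ ⋆ g) n)) (suc x)
      ≡⟨ ⋆-cong {𝟙−e} (λ _ → refl) (λ n → cong (λ z → g (suc n) + - + 1 * z) (unupdate n)) x ⟩
    (𝟙−e ⋆ (λ n → avoidCount (a [ i ]≔ n) i)) (suc x) ∎
    where
    g : ArithFun
    g n = T B 1 (a [ i ]≔ n)

    -- The recurrence refers to the count at the updated vector, where coordinate `i` is overwritten
    -- a second time; only the last value matters.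
    unupdate : ∀ n → (𝟙−e⋆μ ⋆ g) (suc n) ≡ startCount (a [ i ]≔ suc n) i
    unupdate n = trans
      (⋆-cong {𝟙−e⋆μ} (λ _ → refl) (λ k → cong (T B 1) (sym ([]≔-idempotent a i))) n)
      (cong (𝟙−e⋆μ ⋆ (λ k → T B 1 (a [ i ]≔ suc n [ i ]≔ k))) (sym (lookup∘update i a (suc n))))

  -- Empty products are `1`, so the empty tuple factorises only the all-ones vector, where the unit
  -- `T B 0` is `1`.
  enum-[] : ∀ {m} (a : Vec ℕ m) → All (InRange B) a →
            Enumeration (λ t → t ≡ [] × JOF a t) (T B 0 a)
  enum-[] a range with All.all? (ℕ._≟ 1) a
  ... | yes a≡1 = subst (Enumeration _) (sym (T-zero-ones b a≡1))
    (enum-singleton (refl , [] , [] , λ j → sym (lookup⁺ a≡1 j)) λ t → proj₁)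
  ... | no a≢1 = subst (Enumeration _) (sym (T-zero-¬ones b (All.map proj₁ range) a≢1))
    (enum-∅ λ { _ (refl , _ , _ , prods) → a≢1 (lookup⁻ (sym ∘ prods)) })

  -- The injection `g` selects the admissible first coordinates: `id` admits all of them,
  -- `punchIn i` all but `i`.
  enum-heads : ∀ {m n} (a : Vec ℕ m) → All (InRange B) a → StartEnum a →
    (g : Fin n → Fin m) → (∀ {i j} → g i ≡ g j → i ≡ j) →
    Enumeration (λ t → (t ≡ [] × JOF a t) ⊎ ∃ λ i → StartsWith (g i) t × JOF a t)
                (T B 0 a + sum (λ i → startCount a (g i)))
  enum-heads a range E g g-injective = enum-⊎
    (λ { (refl , _) (_ , (_ , _ , ()) , _) })
    (enum-[] a range)
    (enum-∃ (λ { ((_ , _ , refl) , _) ((_ , _ , eq) , _) → g-injective (cong proj₁ (∷-injectiveˡ eq)) }) (E ∘ g))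

  enum-JOF : ∀ {m} (a : Vec ℕ m) → All (InRange B) a → StartEnum a → Enumeration (JOF a) (T B 1 a)
  enum-JOF a range E = subst (Enumeration _) (sym (T-recurrence B 0 a range))
    (enum-⇔ (λ t → mk⇔ (λ { (inj₁ (_ , jof)) → jof ; (inj₂ (_ , _ , jof)) → jof }) (from t))
      (enum-heads a range E id id))
    where
    from : ∀ t → JOF a t → (t ≡ [] × JOF a t) ⊎ ∃ λ i → StartsWith i t × JOF a t
    from []            jof = inj₁ (refl , jof)
    from ((i , d) ∷ s) jof = inj₂ (i , (d , s , refl) , jof)

  -- Dropping the `i`-th summand from the recurrence for `T B 1` is the same as subtracting
  -- `startCount a i`.
  enum-avoid : ∀ {m} (a : Vec ℕ m) → All (InRange B) a → StartEnum a → ∀ i →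
               Enumeration (λ t → ¬ StartsWith i t × JOF a t) (avoidCount a i)
  enum-avoid {suc m} a range E i = subst (Enumeration _) count
    (enum-⇔ (λ t → mk⇔ (to t) (from t)) (enum-heads a range E (punchIn i) (punchIn-injective i _ _)))
    where
    to : ∀ t → (t ≡ [] × JOF a t) ⊎ (∃ λ j → StartsWith (punchIn i j) t × JOF a t) → ¬ StartsWith i t × JOF a t
    to t (inj₁ (refl , jof)) = (λ { (_ , _ , ()) }) , jof
    to t (inj₂ (j , (d , s , refl) , jof)) = (λ { (_ , _ , eq) → punchInᵢ≢i i j (cong proj₁ (∷-injectiveˡ eq)) }) , jof

    from : ∀ t → ¬ StartsWith i t × JOF a t → (t ≡ [] × JOF a t) ⊎ (∃ λ j → StartsWith (punchIn i j) t × JOF a t)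
    from []            (_ , jof) = inj₁ (refl , jof)
    from ((j , d) ∷ s) (¬start , jof) = inj₂
      (punchOut i≢j , (d , s , cong (λ k → (k , d) ∷ s) (sym (punchIn-punchOut i≢j))) , jof)
      where
      i≢j : i ≢ j
      i≢j refl = ¬start (d , s , refl)

    cancel : ∀ x y z → x + z ≡ (x + (y + z)) + - + 1 * y
    cancel = solve-∀

    count : T B 0 a + sum (λ j → startCount a (punchIn i j)) ≡ avoidCount a i
    count = begin
      T B 0 a + sum (λ j → startCount a (punchIn i j))
        ≡⟨ cancel (T B 0 a) (startCount a i) _ ⟩
      (T B 0 a + (startCount a i + sum (λ j → startCount a (punchIn i j)))) + - + 1 * startCount a i
        ≡⟨ cong (λ z → (T B 0 a + z) + - + 1 * startCount a i) (sum-remove {i = i} (startCount a)) ⟨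
      (T B 0 a + sum (startCount a)) + - + 1 * startCount a i
        ≡⟨ cong (_+ - + 1 * startCount a i) (T-recurrence B 0 a range) ⟨
      avoidCount a i ∎

  -- Induction on a bound for the sum of the entries, which drops when a factor of at least `2` is
  -- removed. The possible first factors `suc k` are matched one by one with the terms of `𝟙−e ⋆ H`.
  enum-start : ∀ n {m} (a : Vec ℕ m) → Vec.sum a < n → All (InRange B) a → StartEnum a
  enum-start (suc n) a (s≤s a≤n) range i with lookup a i in aᵢ≡ | lookup⁺ range i
  ... | suc x | _ , x<B = subst (Enumeration _) count
    (enum-⇔ (λ t → mk⇔ (λ { (_ , s , refl , jof) → (_ , s , refl) , jof }) (from t))
      (enum-∃ {P = λ k t → FirstFactor (toℕ k) t}
        (λ { (_ , refl , _) (_ , eq , _) → toℕ-injective (ℕₚ.suc-injective (cong proj₂ (∷-injectiveˡ eq))) }) (enum-factor ∘ toℕ)))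
    where
    FirstFactor : ℕ → List (Fin _ × ℕ) → Set
    FirstFactor k t = ∃ λ s → t ≡ (i , suc k) ∷ s × JOF a t

    H : ArithFun
    H q = avoidCount (a [ i ]≔ q) i

    size : ℕ → ℤ
    size k = ⟦ suc k ∣? suc x ⟧ * (𝟙−e (suc k) * H (suc x / suc k))

    count : sum {suc x} (size ∘ toℕ) ≡ (𝟙−e⋆μ ⋆ (λ q → T B 1 (a [ i ]≔ q))) (suc x)
    count = begin
      sum {suc x} (size ∘ toℕ)   ≡⟨ ∑<-sum (suc x) size ⟨
      ∑< (suc x) size            ≡⟨ ⋆-∑ 𝟙−e H (suc x) ⟨
      (𝟙−e ⋆ H) (suc x)          ≡⟨ startCount-recurrence a i aᵢ≡ ⟨
      startCount a i             ≡⟨ cong (𝟙−e⋆μ ⋆ (λ q → T B 1 (a [ i ]≔ q))) aᵢ≡ ⟩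
      _                          ∎

    from : ∀ t → StartsWith i t × JOF a t → ∃ λ (k : Fin (suc x)) → FirstFactor (toℕ k) t
    from t ((suc d , s , refl) , jof) =
      fromℕ< d<x , s , cong (λ k → (i , suc k) ∷ s) (sym (toℕ-fromℕ< d<x)) , jof
      where
      d<x : d < suc x
      d<x = ∣⇒≤ (subst (suc d ∣_) aᵢ≡ (JOF-∣ {a = a} jof))
    from t ((zero , s , refl) , (() ∷ _ , _))

    enum-factor : ∀ k → Enumeration (FirstFactor k) (size k)
    -- `𝟙−e` vanishes at `1`, in agreement with the ban on factors equal to `1`.
    enum-factor zero = subst (Enumeration _) (sym (ℤₚ.*-zeroʳ ⟦ 1 ∣? suc x ⟧))
      (enum-∅ λ { _ (_ , refl , s≤s () ∷ _ , _) })
    enum-factor (suc k) = by-divisibility (suc (suc k) ∣? suc x)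
      where
      by-divisibility : Dec (suc (suc k) ∣ suc x) → Enumeration (FirstFactor (suc k)) (size (suc k))
      by-divisibility (no k∤x) = subst (Enumeration _) (sym (⟦⟧-*-zero (suc (suc k) ∣? suc x) _ k∤x))
        (enum-∅ λ { _ (_ , refl , jof) → k∤x (subst (suc (suc k) ∣_) aᵢ≡ (JOF-∣ {a = a} jof)) })
      by-divisibility (yes k∣x@(divides (suc q) x≡qk)) = subst (Enumeration _) size≡
        (enum-⇔ (λ t → mk⇔
            (λ { (s , refl , p) → s , refl , Equivalence.to JOF-cons p })
            (λ { (s , refl , p) → s , refl , Equivalence.from JOF-cons p }))
          (enum-map ((i , suc (suc k)) ∷_) ∷-injectiveʳ
            (enum-avoid a′ range′ (enum-start n a′ (ℕₚ.<-≤-trans (sum-[]≔-< a i q<aᵢ) a≤n) range′) i)))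
        where
        a′ = a [ i ]≔ suc q

        kq≡aᵢ : suc (suc k) ℕ.* suc q ≡ lookup a i
        kq≡aᵢ = trans (ℕₚ.*-comm (suc (suc k)) (suc q)) (trans (sym x≡qk) (sym aᵢ≡))

        JOF-cons : ∀ {s} → (¬ StartsWith i s × JOF a′ s) ⇔ JOF a ((i , suc (suc k)) ∷ s)
        JOF-cons = JOF-∷ {a = a} kq≡aᵢ (s≤s (s≤s z≤n))

        q<aᵢ : suc q < lookup a i
        q<aᵢ = subst (suc q <_) kq≡aᵢ (ℕₚ.m<m+n (suc q) (s≤s z≤n))

        range′ : All (InRange B) a′
        range′ = All-[]≔ i range (s≤s z≤n , ℕₚ.≤-trans (ℕₚ.<⇒≤ (subst (suc q <_) aᵢ≡ q<aᵢ)) x<B)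

        size≡ : H (suc q) ≡ size (suc k)
        size≡ = begin
          H (suc q)                                ≡⟨ cong H (trans (cong (_/ suc (suc k)) x≡qk) (m*n/n≡m (suc q) (suc (suc k)))) ⟨
          H (suc x / suc (suc k))                  ≡⟨ ℤₚ.*-identityˡ _ ⟨
          + 1 * H (suc x / suc (suc k))            ≡⟨ ⟦⟧-*-one (suc (suc k) ∣? suc x) _ k∣x ⟨
          size (suc k)                             ∎

≤∣∣ᵥ : ∀ {m} (a : Vector ℕ m) j → a j ≤ ∣ a ∣ᵥ
≤∣∣ᵥ a zero    = ℕₚ.m≤m+n (head a) _
≤∣∣ᵥ a (suc j) = ℕₚ.≤-trans (≤∣∣ᵥ (tail a) j) (ℕₚ.m≤n+m _ (head a))

theorem4 : (m : ℕ) → 1 ≤ m → (a : Vector ℕ m) → (∀ j → 2 ≤ a j) →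
  -- N_a: the joint ordered factorisations of a are exactly the entries
  -- of a duplicate-free list xs, so N_a = length xs, and N_a equals the sum
  (Σ (List (List (Fin m × ℕ))) λ xs →
      Unique xs
      × (∀ t → t ∈ xs ⇔ IsJointOrdFact a t)
      × + length xs ≡ boxSum a (summand a))
  -- only finitely many nonzero terms: terms with some l_j > a_j vanish
  × (∀ (l : Vector ℕ m) → (∀ j → 1 ≤ l j) → (∃ λ j → a j < l j) →
      summand a l ≡ + 0)
theorem4 m _ a 2≤a =
  (list E , unique E , ∈⇔P E , length≡size E) ,
  λ { l _ (j , a<l) → summand-vanish a l j (ℕₚ.<⇒≤ (2≤a j)) (ℕₚ.<⇒≤ a<l) }
  where
  -- As a `Vec`, the tuple satisfies update laws such as `[]≔-idempotent` up to `≡`; for functions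
  -- they would hold only pointwise.
  v = tabulate a

  range : All (InRange (suc ∣ a ∣ᵥ)) v
  range = tabulate⁺ λ j → ℕₚ.<⇒≤ (2≤a j) , ℕₚ.m≤n⇒m≤1+n (≤∣∣ᵥ a j)

  JOF-tabulate : ∀ t → JOF v t ⇔ IsJointOrdFact a t
  JOF-tabulate t = mk⇔
    (λ { (2≤t , linked , prods) → 2≤t , linked , λ j → trans (prods j) (lookup∘tabulate a j) })
    (λ { (2≤t , linked , prods) → 2≤t , linked , λ j → trans (prods j) (sym (lookup∘tabulate a j)) })

  E : Enumeration (IsJointOrdFact a) (boxSum a (summand a))
  -- The truncation bound `suc ∣ a ∣ᵥ` serves all coordinates at once. It must exceed each `a j`
  -- strictly, because the box includes the index `a j` itself.
  E = subst (Enumeration _) (sym (boxSum-summand (suc ∣ a ∣ᵥ) a λ j → 2≤a j , s≤s (≤∣∣ᵥ a j)))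
    (enum-⇔ JOF-tabulate
      (enum-JOF ∣ a ∣ᵥ v range (enum-start ∣ a ∣ᵥ (suc (Vec.sum v)) v ℕₚ.≤-refl range)))
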